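{- For every integer $g>1$, $$V_{g-1}(5)=\begin{cases}2\cdot3^{g}\,5^{g/2}\,F_{g-1}, & g\text{ even},\\ 2\cdot3^{g}\,5^{(g-1)/2}\,(F_{g-2}+F_{g}), & g\text{ odd}.\end{cases}$$
   Context: For integers $n\ge1$, $m\ge3$, the $\mathrm{SU}(3)$ Verlinde sum is $$V_n(m)=3^nm^{2n}\sum_{\substack{(j,\ell,k)\in(\mathbb Z/m\mathbb Z\setminus\{0\})^3\\ j+\ell+k\equiv 0 \bmod m}}\Big(8\sin\frac{\pi j}{m}\sin\frac{\pi\ell}{m}\sin\frac{\pi k}{m}\Big)^{ -2n}.$$ $F_n$ is the $n$th Fibonacci number ($F_1=F_2=1$, $F_{n+1}=F_n+F_{n-1}$). -}

module Defs where

open import Algebra.Bundles.Raw using (RawRing)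
import Algebra.Definitions.RawSemiring as RawSemiringDefinitions
open import Data.Fin.Base using (Fin; toℕ)
open import Data.Fin.Properties using (toℕ<n)
open import Data.Integer.Base as ℤ using (+_; +<+)
import Data.Integer.Properties as ℤ
open import Data.List.Base as List using (List)
open import Data.Nat.Base as ℕ using (ℕ; zero; suc; pred; _!; z≤n; s≤s)
open import Data.Nat.Divisibility using (_∣?_)
import Data.Nat.Properties as ℕ
open import Data.Product.Base using (Σ; _×_; _,_; proj₁; proj₂; ∃-syntax)
open import Data.Rational.Base as ℚ using (ℚ; 0ℚ; 1ℚ; ½; _/_; ∣_∣; 1/_)
import Data.Rational.Properties as ℚ
open import Data.Rational.Solver using (module +-*-Solver)
import Data.Rational.Unnormalised.Base as ℚᵘ
import Data.Rational.Unnormalised.Properties as ℚᵘ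
open import Data.Sum.Base using ([_,_]′)
open import Level using (0ℓ)
open import Relation.Binary.PropositionalEquality using (_≡_; _≢_; refl; sym; trans; cong; cong₂; subst; subst₂; module ≡-Reasoning)
open import Relation.Nullary using (yes; no; contradiction)

open RawSemiringDefinitions ℚ.+-*-rawSemiring using () renaming (_^_ to _^ℚ_)

module RationalLemmas where

  open import Data.Rational.Base using (_+_; _*_; _-_; -_; _≤_; _<_)
  open ℚ.≤-Reasoning
  private module ≡ = ≡-Reasoning
  open +-*-Solver using (solve; _:+_; _:*_; _:-_; :-_; _:=_; con)

  id-arch : ∀ i e c r → i * (e * (c * r)) ≡ (c * e) * (i * r)
  id-arch = solve 4 (λ i e c r → i :* (e :* (c :* r)) := (c :* e) :* (i :* r)) refl

  id-½ : ∀ e → ½ * e + ½ * e ≡ e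
  id-½ = solve 1 (λ e → con ½ :* e :+ con ½ :* e := e) refl

  id-neg : ∀ a b → a - b ≡ - (b - a)
  id-neg = solve 2 (λ a b → a :- b := :- (b :- a)) refl

  id-tri : ∀ a b c → (a - b) + (b - c) ≡ a - c
  id-tri = solve 3 (λ a b c → (a :- b) :+ (b :- c) := a :- c) refl

  id-add : ∀ a b → a ≡ b + (a - b)
  id-add = solve 2 (λ a b → a := b :+ (a :- b)) refl

  id-plus : ∀ a b c d → (a + b) - (c + d) ≡ (a - c) + (b - d)
  id-plus = solve 4 (λ a b c d → (a :+ b) :- (c :+ d) := (a :- c) :+ (b :- d)) refl

  id-minus : ∀ a b → - (a - b) ≡ - a - - b
  id-minus = solve 2 (λ a b → :- (a :- b) := :- a :- :- b) refl

  id-times : ∀ a b c d → a * b - c * d ≡ a * (b - d) + d * (a - c)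
  id-times = solve 4 (λ a b c d → a :* b :- c :* d := a :* (b :- d) :+ d :* (a :- c)) refl

  id-inv : ∀ a b c d → c * (b * d) - d * (a * c) ≡ (c * d) * (b - a)
  id-inv = solve 4 (λ a b c d → c :* (b :* d) :- d :* (a :* c) := (c :* d) :* (b :- a)) refl

  id-sign : ∀ s y → (- 1ℚ * s) * y ≡ - (s * y)
  id-sign = solve 2 (λ s y → (:- con 1ℚ :* s) :* y := :- (s :* y)) refl

  id-pow : ∀ a b p q → a * p - b * q ≡ a * (p - q) + q * (a - b)
  id-pow = solve 4 (λ a b p q → a :* p :- b :* q := a :* (p :- q) :+ q :* (a :- b)) refl

  id-double : ∀ m p d → m * (p * d) + (m * p) * d ≡ ((m + m) * p) * d
  id-double = solve 3 (λ m p d → m :* (p :* d) :+ (m :* p) :* d := ((m :+ m) :* p) :* d) refl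

  id-ratio : ∀ b p c u v → (b * (b * p)) * ((c * u) * v) ≡ (p * c) * ((b * u) * (b * v))
  id-ratio = solve 5 (λ b p c u v → (b :* (b :* p)) :* ((c :* u) :* v) := (p :* c) :* ((b :* u) :* (b :* v))) refl

  id-half : ∀ e → e * (½ * 1ℚ) ≡ ½ * e
  id-half = solve 1 (λ e → e :* (con ½ :* con 1ℚ) := con ½ :* e) refl

  id-twice : ∀ i → (i + i) * ½ ≡ i
  id-twice = solve 1 (λ i → (i :+ i) :* con ½ := i) refl

  id-assoc : ∀ h a b → h * (a * b) ≡ a * (h * b)
  id-assoc = solve 3 (λ h a b → h :* (a :* b) := a :* (h :* b)) refl

  id-cross : ∀ a b c d → (a * b) * (c * d) ≡ (a * c) * (b * d)
  id-cross = solve 4 (λ a b c d → (a :* b) :* (c :* d) := (a :* c) :* (b :* d)) refl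

  id-dist : ∀ a b d → a * d + b * d ≡ (a + b) * d
  id-dist = solve 3 (λ a b d → a :* d :+ b :* d := (a :+ b) :* d) refl

  id-diffₗ : ∀ a b c → (a + b) - c ≡ (a - c) + b
  id-diffₗ = solve 3 (λ a b c → (a :+ b) :- c := (a :- c) :+ b) refl

  id-angle₁ : ∀ a q → (a - 0ℚ) * q ≡ a * q - 0ℚ
  id-angle₁ = solve 2 (λ a q → (a :- con 0ℚ) :* q := a :* q :- con 0ℚ) refl

  id-angle₂ : ∀ a q → (a - 0ℚ) * (1ℚ - q) ≡ a - a * q
  id-angle₂ = solve 2 (λ a q → (a :- con 0ℚ) :* (con 1ℚ :- q) := a :- a :* q) refl

  id-minus0 : ∀ a b → a * b - 0ℚ ≡ (a - 0ℚ) * (b - 0ℚ)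
  id-minus0 = solve 2 (λ a b → a :* b :- con 0ℚ := (a :- con 0ℚ) :* (b :- con 0ℚ)) refl

  id-term : ∀ s a b c → s * (a * c) - s * (b * c) ≡ s * ((a - b) * c)
  id-term = solve 4 (λ s a b c → s :* (a :* c) :- s :* (b :* c) := s :* ((a :- b) :* c)) refl

  id-last : ∀ b d c → (b * d) * c ≡ (b * c) * d
  id-last = solve 3 (λ b d c → (b :* d) :* c := (b :* c) :* d) refl

  id-cancel : ∀ a c → (a + c) - c ≡ a
  id-cancel = solve 2 (λ a c → (a :+ c) :- c := a) refl

  id-swap : ∀ i x c → i * (x * c) ≡ (x * i) * c
  id-swap = solve 3 (λ i x c → i :* (x :* c) := (x :* i) :* c) refl

  ι : ℕ → ℚ
  ι n = + n / 1

  r : (n : ℕ) .{{_ : ℕ.NonZero n}} → ℚ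
  r n = + 1 / n

  to-/ : ∀ i d → ℚ.toℚᵘ (i / suc d) ℚᵘ.≃ ℚᵘ.mkℚᵘ i d
  to-/ i d = ℚ.toℚᵘ-fromℚᵘ (ℚᵘ.mkℚᵘ i d)

  ι-+ : ∀ m n → ι (m ℕ.+ n) ≡ ι m + ι n
  ι-+ m n = ℚ.toℚᵘ-injective (ℚᵘ.≃-trans (to-/ (+ (m ℕ.+ n)) 0)
    (ℚᵘ.≃-trans (ℚᵘ.*≡* (cong (ℤ._* + 1) (cong₂ ℤ._+_ (sym (ℤ.*-identityʳ (+ m))) (sym (ℤ.*-identityʳ (+ n))))))
    (ℚᵘ.≃-trans (ℚᵘ.+-cong (ℚᵘ.≃-sym (to-/ (+ m) 0)) (ℚᵘ.≃-sym (to-/ (+ n) 0)))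
    (ℚᵘ.≃-sym (ℚ.toℚᵘ-homo-+ (ι m) (ι n))))))

  ι-* : ∀ m n → ι (m ℕ.* n) ≡ ι m * ι n
  ι-* m n = ℚ.toℚᵘ-injective (ℚᵘ.≃-trans (to-/ (+ (m ℕ.* n)) 0)
    (ℚᵘ.≃-trans (ℚᵘ.*≡* (cong (ℤ._* + 1) (ℤ.pos-* m n)))
    (ℚᵘ.≃-trans (ℚᵘ.*-cong (ℚᵘ.≃-sym (to-/ (+ m) 0)) (ℚᵘ.≃-sym (to-/ (+ n) 0)))
    (ℚᵘ.≃-sym (ℚ.toℚᵘ-homo-* (ι m) (ι n))))))

  ι-mono : ∀ {m n} → m ℕ.≤ n → ι m ≤ ι n
  ι-mono {m} {n} p = ℚ.toℚᵘ-cancel-≤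
    (ℚᵘ.≤-respˡ-≃ (ℚᵘ.≃-sym (to-/ (+ m) 0)) (ℚᵘ.≤-respʳ-≃ (ℚᵘ.≃-sym (to-/ (+ n) 0))
      (ℚᵘ.*≤* (ℤ.*-monoʳ-≤-nonNeg (+ 1) (ℤ.+≤+ p)))))

  i/n : ∀ i n .{{_ : ℕ.NonZero n}} → ι n * (+ i / n) ≡ ι i
  i/n i (suc d) = ℚ.toℚᵘ-injective (ℚᵘ.≃-trans (ℚ.toℚᵘ-homo-* (ι (suc d)) (+ i / suc d))
    (ℚᵘ.≃-trans (ℚᵘ.*-cong (to-/ (+ suc d) 0) (to-/ (+ i) d))
    (ℚᵘ.≃-trans (ℚᵘ.*≡* (lemma i d)) (ℚᵘ.≃-sym (to-/ (+ i) 0)))))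
    where
    lemma : ∀ i d → (+ suc d ℤ.* + i) ℤ.* + 1 ≡ + i ℤ.* (+ suc (d ℕ.+ 0))
    lemma i d rewrite ℕ.+-identityʳ d = trans (ℤ.*-identityʳ _) (ℤ.*-comm (+ suc d) (+ i))

  ι>0 : ∀ n .{{_ : ℕ.NonZero n}} → 0ℚ < ι n
  ι>0 (suc n) = ℚ.<-≤-trans (ℚ.positive⁻¹ 1ℚ) (ι-mono {1} {suc n} (s≤s z≤n))

  0≤ι : ∀ n → 0ℚ ≤ ι n
  0≤ι n = ι-mono {0} {n} z≤n

  ι< : ∀ n → ι n < ι (suc n)
  ι< n = begin-strict
    ι n         ≡⟨ ℚ.+-identityˡ (ι n) ⟨
    0ℚ + ι n    <⟨ ℚ.+-monoˡ-< (ι n) (ι>0 1) ⟩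
    ι 1 + ι n   ≡⟨ ι-+ 1 n ⟨
    ι (suc n)   ∎

  *-monoˡ : ∀ {a b c} → 0ℚ ≤ c → a ≤ b → c * a ≤ c * b
  *-monoˡ {c = c} 0≤c = ℚ.*-monoˡ-≤-nonNeg c {{ℚ.nonNegative 0≤c}}

  *-monoʳ : ∀ {a b c} → 0ℚ ≤ c → a ≤ b → a * c ≤ b * c
  *-monoʳ {c = c} 0≤c = ℚ.*-monoʳ-≤-nonNeg c {{ℚ.nonNegative 0≤c}}

  *-mono : ∀ {a b c d} → 0ℚ ≤ a → 0ℚ ≤ d → a ≤ b → c ≤ d → a * c ≤ b * d
  *-mono 0≤a 0≤d a≤b c≤d = ℚ.≤-trans (*-monoˡ 0≤a c≤d) (*-monoʳ 0≤d a≤b)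

  0≤* : ∀ {a b} → 0ℚ ≤ a → 0ℚ ≤ b → 0ℚ ≤ a * b
  0≤* {a} {b} 0≤a 0≤b = subst (_≤ a * b) (ℚ.*-zeroʳ a) (*-monoˡ 0≤a 0≤b)

  0<* : ∀ {a b} → 0ℚ < a → 0ℚ < b → 0ℚ < a * b
  0<* {a} {b} 0<a 0<b = subst (_< a * b) (ℚ.*-zeroʳ a) (ℚ.*-monoʳ-<-pos a {{ℚ.positive 0<a}} 0<b)

  0≤+ : ∀ {a b} → 0ℚ ≤ a → 0ℚ ≤ b → 0ℚ ≤ a + b
  0≤+ = ℚ.+-mono-≤

  cancel-≤ : ∀ {a b c} → 0ℚ < c → c * a ≤ c * b → a ≤ b
  cancel-≤ {a} {b} {c} 0<c p = ℚ.*-cancelʳ-≤-pos c {{ℚ.positive 0<c}} (subst₂ _≤_ (ℚ.*-comm c a) (ℚ.*-comm c b) p)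

  cancel-< : ∀ {a b c} → 0ℚ < c → c * a < c * b → a < b
  cancel-< {a} {b} {c} 0<c p = ℚ.*-cancelˡ-<-nonNeg c {{ℚ.nonNegative (ℚ.<⇒≤ 0<c)}} p

  cancel-≡ : ∀ {a b c} → 0ℚ < c → c * a ≡ c * b → a ≡ b
  cancel-≡ 0<c p = ℚ.≤-antisym (cancel-≤ 0<c (ℚ.≤-reflexive p)) (cancel-≤ 0<c (ℚ.≤-reflexive (sym p)))

  ≤+ : ∀ {a b} → 0ℚ ≤ b → a ≤ a + b
  ≤+ {a} {b} 0≤b = subst (_≤ a + b) (ℚ.+-identityʳ a) (ℚ.+-monoʳ-≤ a 0≤b)

  0≤- : ∀ {a b} → a ≤ b → 0ℚ ≤ b - a
  0≤- {a} {b} p = subst (_≤ b - a) (ℚ.+-inverseʳ a) (ℚ.+-monoˡ-≤ (- a) p)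

  0<- : ∀ {a b} → a < b → 0ℚ < b - a
  0<- {a} {b} p = subst (_< b - a) (ℚ.+-inverseʳ a) (ℚ.+-monoˡ-< (- a) p)

  r>0 : ∀ n .{{_ : ℕ.NonZero n}} → 0ℚ < r n
  r>0 n = cancel-< {c = ι n} (ι>0 n) (subst₂ _<_ (sym (ℚ.*-zeroʳ (ι n))) (sym (i/n 1 n)) (ι>0 1))

  r-* : ∀ m n .{{_ : ℕ.NonZero m}} .{{_ : ℕ.NonZero n}} .{{_ : ℕ.NonZero (m ℕ.* n)}} → r (m ℕ.* n) ≡ r m * r n
  r-* m n = cancel-≡ {c = ι (m ℕ.* n)} (ι>0 (m ℕ.* n)) (≡.begin
    ι (m ℕ.* n) * r (m ℕ.* n)       ≡.≡⟨ i/n 1 (m ℕ.* n) ⟩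
    1ℚ                             ≡.≡⟨ ℚ.*-identityˡ 1ℚ ⟨
    1ℚ * 1ℚ                        ≡.≡⟨ cong₂ _*_ (i/n 1 m) (i/n 1 n) ⟨
    (ι m * r m) * (ι n * r n)      ≡.≡⟨ id-cross (ι m) (r m) (ι n) (r n) ⟩
    (ι m * ι n) * (r m * r n)      ≡.≡⟨ cong (_* (r m * r n)) (ι-* m n) ⟨
    ι (m ℕ.* n) * (r m * r n)       ≡.∎)

  -- a ≤ nq implies a/n ≤ q
  *r≤ : ∀ a q n .{{_ : ℕ.NonZero n}} → a ≤ ι n * q → a * r n ≤ q
  *r≤ a q n a≤nq = cancel-≤ {c = ι n} (ι>0 n) (begin
    ι n * (a * r n)   ≡⟨ id-assoc (ι n) a (r n) ⟩
    a * (ι n * r n)   ≡⟨ cong (a *_) (i/n 1 n) ⟩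
    a * 1ℚ            ≡⟨ ℚ.*-identityʳ a ⟩
    a                 ≤⟨ a≤nq ⟩
    ι n * q           ∎)

  ½r≤r : ∀ i → ½ * r (suc i) ≤ r (suc (suc i))
  ½r≤r i = *r≤ ½ (r (2 ℕ.+ i)) (suc i) (cancel-≤ {c = ι (2 ℕ.+ i)} (ι>0 (2 ℕ.+ i)) (begin
    ι (2 ℕ.+ i) * ½                         ≤⟨ *-monoʳ (ℚ.<⇒≤ (ℚ.positive⁻¹ ½)) (ι-mono (s≤s (ℕ.m≤n+m (suc i) i))) ⟩
    ι (suc i ℕ.+ suc i) * ½                 ≡⟨ cong (_* ½) (ι-+ (suc i) (suc i)) ⟩
    (ι (suc i) + ι (suc i)) * ½             ≡⟨ id-twice (ι (suc i)) ⟩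
    ι (suc i)                               ≡⟨ ℚ.*-identityʳ (ι (suc i)) ⟨
    ι (suc i) * 1ℚ                          ≡⟨ cong (ι (suc i) *_) (i/n 1 (2 ℕ.+ i)) ⟨
    ι (suc i) * (ι (2 ℕ.+ i) * r (2 ℕ.+ i))   ≡⟨ id-assoc (ι (suc i)) (ι (2 ℕ.+ i)) (r (2 ℕ.+ i)) ⟩
    ι (2 ℕ.+ i) * (ι (suc i) * r (2 ℕ.+ i))   ∎))

  ½> : ∀ {ε} → 0ℚ < ε → 0ℚ < ½ * ε
  ½> = 0<* (ℚ.positive⁻¹ ½)

  ½+½ : ∀ ε → ½ * ε + ½ * ε ≡ ε
  ½+½ = id-½

  bound : (q : ℚ) → ∃[ n ] q ≤ ι n
  bound q@(ℚ.mkℚ (+ n) d _) = n , ℚ.toℚᵘ-cancel-≤ (ℚᵘ.≤-respʳ-≃ (ℚᵘ.≃-sym (to-/ (+ n) 0))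
    (ℚᵘ.*≤* (ℤ.*-monoˡ-≤-nonNeg (+ n) (ℤ.+≤+ (s≤s z≤n)))))
  bound q@(ℚ.mkℚ (ℤ.-[1+ n ]) d _) = 0 , ℚ.<⇒≤ (ℚ.negative⁻¹ q)

  reciprocal : ∀ {ε} → 0ℚ < ε → Σ ℚ λ e → 0ℚ < e × ε * e ≡ 1ℚ
  reciprocal {ε} 0<ε = 1/ ε , ℚ.positive⁻¹ (1/ ε) {{ℚ.1/pos⇒pos ε}} , ℚ.*-inverseʳ ε
    where instance
      pos : ℚ.Positive ε
      pos = ℚ.positive 0<ε
      nz : ℚ.NonZero ε
      nz = ℚ.pos⇒nonZero ε

  archimedes : ∀ C {ε} → 0ℚ < ε → ∃[ N ] (∀ n → N ℕ.≤ n → C * r (suc n) < ε)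
  archimedes C {ε} 0<ε =
    let e , 0<e , εe≡1 = reciprocal 0<ε
        N , Ce≤N = bound (C * e)
    in N , λ n N≤n → cancel-< {c = e} 0<e (cancel-< {c = ι (suc n)} (ι>0 (suc n)) (begin-strict
    ι (suc n) * (e * (C * r (suc n))) ≡⟨ id-arch (ι (suc n)) e C (r (suc n)) ⟩
    (C * e) * (ι (suc n) * r (suc n)) ≡⟨ cong ((C * e) *_) (i/n 1 (suc n)) ⟩
    (C * e) * 1ℚ                     ≡⟨ ℚ.*-identityʳ (C * e) ⟩
    C * e                            ≤⟨ Ce≤N ⟩
    ι N                              ≤⟨ ι-mono N≤n ⟩
    ι n                              <⟨ ι< n ⟩
    ι (suc n)                        ≡⟨ ℚ.*-identityʳ (ι (suc n)) ⟨
    ι (suc n) * 1ℚ                   ≡⟨ cong (ι (suc n) *_) εe≡1 ⟨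
    ι (suc n) * (ε * e)              ≡⟨ cong (ι (suc n) *_) (ℚ.*-comm ε e) ⟩
    ι (suc n) * (e * ε)              ∎))

  shrink : ∀ C {ε} → 0ℚ < ε → Σ ℚ λ δ → 0ℚ < δ × C * δ < ε
  shrink C 0<ε =
    let N , h = archimedes C 0<ε
    in r (suc N) , r>0 (suc N) , h N ℕ.≤-refl

  ∣-∣-sym : ∀ a b → ∣ a - b ∣ ≡ ∣ b - a ∣
  ∣-∣-sym a b = trans (cong ∣_∣ (id-neg a b)) (ℚ.∣-p∣≡∣p∣ (b - a))

  triangle : ∀ a b c → ∣ a - c ∣ ≤ ∣ a - b ∣ + ∣ b - c ∣
  triangle a b c = subst (λ d → ∣ d ∣ ≤ ∣ a - b ∣ + ∣ b - c ∣)
    (id-tri a b c) (ℚ.∣p+q∣≤∣p∣+∣q∣ (a - b) (b - c))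

open RationalLemmas using (r; triangle)

-- The real numbers are Cauchy sequences of rationals, and all operations act termwise.

IsCauchy : (ℕ → ℚ) → Set
IsCauchy x = ∀ {ε} → 0ℚ ℚ.< ε →
  ∃[ N ] (∀ m n → N ℕ.≤ m → N ℕ.≤ n → ∣ x m ℚ.- x n ∣ ℚ.< ε)

record ℝ : Set where
  constructor mkℝ
  field
    seq    : ℕ → ℚ
    cauchy : IsCauchy seq
open ℝ public

infix 4 _≃_ _<_ _#_

record _≃_ (x y : ℝ) : Set where
  constructor mk≃
  field
    close : ∀ {ε} → 0ℚ ℚ.< ε → ∃[ N ] (∀ n → N ℕ.≤ n → ∣ seq x n ℚ.- seq y n ∣ ℚ.< ε)

record _<_ (x y : ℝ) : Set where
  constructor mk<
  field
    gap   : ℚ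
    gap>0 : 0ℚ ℚ.< gap
    from  : ∃[ N ] (∀ n → N ℕ.≤ n → gap ℚ.≤ seq y n ℚ.- seq x n)

-- Apartness, the constructive form of x ≠ y.
record _#_ (x y : ℝ) : Set where
  constructor mk#
  field
    gap   : ℚ
    gap>0 : 0ℚ ℚ.< gap
    from  : ∃[ N ] (∀ n → N ℕ.≤ n → gap ℚ.≤ ∣ seq x n ℚ.- seq y n ∣)

module CauchyLemmas where

  open RationalLemmas
  open import Data.Rational.Base using (_+_; _*_; _-_; -_; _≤_)
  open ℚ.≤-Reasoning

  inv : ℚ → ℚ
  inv q with q ℚ.≟ 0ℚ
  ... | yes _  = 0ℚ
  ... | no q≢0 = (1/ q) {{ℚ.≢-nonZero q≢0}}

  inv-inverse : ∀ {q} → q ≢ 0ℚ → q * inv q ≡ 1ℚ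
  inv-inverse {q} q≢0 with q ℚ.≟ 0ℚ
  ... | yes q≡0 = contradiction q≡0 q≢0
  ... | no  nz  = ℚ.*-inverseʳ q {{ℚ.≢-nonZero nz}}

  abstract

    constant : ∀ q → IsCauchy (λ _ → q)
    constant q 0<ε = 0 , λ _ _ _ _ → subst (ℚ._< _) (sym (cong ∣_∣ (ℚ.+-inverseʳ q))) 0<ε

    -- The sequence converges if it is eventually close to one of its terms.
    fromHalf : ∀ {x} → (∀ {ε} → 0ℚ ℚ.< ε → ∃[ N ] (∀ n → N ℕ.≤ n → ∣ x n - x N ∣ ℚ.< ε)) → IsCauchy x
    fromHalf {x} h {ε} 0<ε = let N , close = h (½> 0<ε) in N , λ m n N≤m N≤n → begin-strict
      ∣ x m - x n ∣                   ≤⟨ triangle (x m) (x N) (x n) ⟩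
      ∣ x m - x N ∣ + ∣ x N - x n ∣   ≡⟨ cong₂ _+_ (refl {x = ∣ x m - x N ∣}) (∣-∣-sym (x N) (x n)) ⟩
      ∣ x m - x N ∣ + ∣ x n - x N ∣   <⟨ ℚ.+-mono-< (close m N≤m) (close n N≤n) ⟩
      ½ * ε + ½ * ε                   ≡⟨ ½+½ ε ⟩
      ε                               ∎

    max : (ℕ → ℚ) → ℕ → ℚ
    max x zero    = 1ℚ
    max x (suc n) = max x n ℚ.⊔ ∣ x n ∣

    max-≥1 : ∀ x n → 1ℚ ≤ max x n
    max-≥1 x zero    = ℚ.≤-refl
    max-≥1 x (suc n) = ℚ.≤-trans (max-≥1 x n) (ℚ.p≤p⊔q (max x n) ∣ x n ∣)

    max-≥ : ∀ x {i} n → i ℕ.< n → ∣ x i ∣ ≤ max x n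
    max-≥ x {i} (suc n) i<1+n =
      [ (λ i<n → ℚ.≤-trans (max-≥ x n i<n) (ℚ.p≤p⊔q (max x n) ∣ x n ∣))
      , (λ i≡n → subst (λ j → ∣ x j ∣ ≤ max x (suc n)) (sym i≡n) (ℚ.p≤q⊔p (max x n) ∣ x n ∣))
      ]′ (ℕ.m<1+n⇒m<n∨m≡n i<1+n)

    bounded : ∀ {x} → IsCauchy x → Σ ℚ λ B → 1ℚ ≤ B × (∀ n → ∣ x n ∣ ≤ B)
    bounded {x} cx = B + 1ℚ , ℚ.≤-trans (max-≥1 x (suc N)) B≤B+1 , below
      where
      N : ℕ
      N = proj₁ (cx {1ℚ} (ι>0 1))
      close : ∀ m n → N ℕ.≤ m → N ℕ.≤ n → ∣ x m - x n ∣ ℚ.< 1ℚ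
      close = proj₂ (cx {1ℚ} (ι>0 1))
      B : ℚ
      B = max x (suc N)
      B≤B+1 : B ≤ B + 1ℚ
      B≤B+1 = ≤+ (0≤ι 1)
      below : ∀ n → ∣ x n ∣ ≤ B + 1ℚ
      below n = [ (λ n≤N → ℚ.≤-trans (max-≥ x (suc N) (s≤s n≤N)) B≤B+1) , far n ]′ (ℕ.≤-total n N)
        where
        far : ∀ n → N ℕ.≤ n → ∣ x n ∣ ≤ B + 1ℚ
        far n N≤n = begin
          ∣ x n ∣                    ≡⟨ cong ∣_∣ (id-add (x n) (x N)) ⟩
          ∣ x N + (x n - x N) ∣      ≤⟨ ℚ.∣p+q∣≤∣p∣+∣q∣ (x N) (x n - x N) ⟩
          ∣ x N ∣ + ∣ x n - x N ∣    ≤⟨ ℚ.+-mono-≤ (max-≥ x (suc N) ℕ.≤-refl) (ℚ.<⇒≤ (close n N N≤n ℕ.≤-refl)) ⟩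
          B + 1ℚ                     ∎

    plus : ∀ {x y} → IsCauchy x → IsCauchy y → IsCauchy (λ n → x n + y n)
    plus {x} {y} cx cy {ε} 0<ε = let M , hx = cx (½> 0<ε) ; N , hy = cy (½> 0<ε) in M ℕ.⊔ N , λ m n p q → begin-strict
      ∣ (x m + y m) - (x n + y n) ∣     ≡⟨ cong ∣_∣ (id-plus (x m) (y m) (x n) (y n)) ⟩
      ∣ (x m - x n) + (y m - y n) ∣     ≤⟨ ℚ.∣p+q∣≤∣p∣+∣q∣ (x m - x n) (y m - y n) ⟩
      ∣ x m - x n ∣ + ∣ y m - y n ∣     <⟨ ℚ.+-mono-< (hx m n (ℕ.m⊔n≤o⇒m≤o M N p) (ℕ.m⊔n≤o⇒m≤o M N q)) (hy m n (ℕ.m⊔n≤o⇒n≤o M N p) (ℕ.m⊔n≤o⇒n≤o M N q)) ⟩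
      ½ * ε + ½ * ε                     ≡⟨ ½+½ ε ⟩
      ε                                 ∎

    minus : ∀ {x} → IsCauchy x → IsCauchy (λ n → - x n)
    minus {x} cx 0<ε = let N , h = cx 0<ε in N , λ m n p q → subst (ℚ._< _)
      (trans (sym (ℚ.∣-p∣≡∣p∣ (x m - x n))) (cong ∣_∣ (id-minus (x m) (x n))))
      (h m n p q)

    times : ∀ {x y} → IsCauchy x → IsCauchy y → IsCauchy (λ n → x n * y n)
    times {x} {y} cx cy {ε} 0<ε =
      let A , 1≤A , hA = bounded {x} cx
          B , 1≤B , hB = bounded {y} cy
          δ , 0<δ , Aδ = shrink A (½> 0<ε)
          γ , 0<γ , Bγ = shrink B (½> 0<ε)
          M , hx = cx 0<γ
          N , hy = cy 0<δ
      in M ℕ.⊔ N , λ m n p q → begin-strict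
      ∣ x m * y m - x n * y n ∣
        ≡⟨ cong ∣_∣ (id-times (x m) (y m) (x n) (y n)) ⟩
      ∣ x m * (y m - y n) + y n * (x m - x n) ∣
        ≤⟨ ℚ.∣p+q∣≤∣p∣+∣q∣ (x m * (y m - y n)) (y n * (x m - x n)) ⟩
      ∣ x m * (y m - y n) ∣ + ∣ y n * (x m - x n) ∣
        ≡⟨ cong₂ _+_ (ℚ.∣p*q∣≡∣p∣*∣q∣ (x m) (y m - y n)) (ℚ.∣p*q∣≡∣p∣*∣q∣ (y n) (x m - x n)) ⟩
      ∣ x m ∣ * ∣ y m - y n ∣ + ∣ y n ∣ * ∣ x m - x n ∣
        ≤⟨ ℚ.+-mono-≤
             (*-mono (ℚ.0≤∣p∣ (x m)) (ℚ.<⇒≤ 0<δ) (hA m) (ℚ.<⇒≤ (hy m n (ℕ.m⊔n≤o⇒n≤o M N p) (ℕ.m⊔n≤o⇒n≤o M N q))))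
             (*-mono (ℚ.0≤∣p∣ (y n)) (ℚ.<⇒≤ 0<γ) (hB n) (ℚ.<⇒≤ (hx m n (ℕ.m⊔n≤o⇒m≤o M N p) (ℕ.m⊔n≤o⇒m≤o M N q)))) ⟩
      A * δ + B * γ
        <⟨ ℚ.+-mono-< Aδ Bγ ⟩
      ½ * ε + ½ * ε
        ≡⟨ ½+½ ε ⟩
      ε ∎

    inverse : ∀ {x δ} → IsCauchy x → 0ℚ ℚ.< δ → ∃[ N ] (∀ n → N ℕ.≤ n → δ ≤ ∣ x n - 0ℚ ∣) →
              IsCauchy (λ n → inv (x n))
    inverse {x} {δ} cx 0<δ (M , far) {ε} 0<ε = M ℕ.⊔ N , λ m n p q →
      let M≤m = ℕ.m⊔n≤o⇒m≤o M N p
          M≤n = ℕ.m⊔n≤o⇒m≤o M N q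
          a = x m ; b = x n ; a′ = inv a ; b′ = inv b
      in begin-strict
      ∣ a′ - b′ ∣                          ≡⟨ cong ∣_∣ (cong₂ _-_ (sym (ℚ.*-identityʳ a′)) (sym (ℚ.*-identityʳ b′))) ⟩
      ∣ a′ * 1ℚ - b′ * 1ℚ ∣                ≡⟨ cong ∣_∣ (cong₂ (λ u v → a′ * u - b′ * v) (sym (inv-inverse (nz n M≤n))) (sym (inv-inverse (nz m M≤m)))) ⟩
      ∣ a′ * (b * b′) - b′ * (a * a′) ∣    ≡⟨ cong ∣_∣ (id-inv a b a′ b′) ⟩
      ∣ (a′ * b′) * (b - a) ∣              ≡⟨ ℚ.∣p*q∣≡∣p∣*∣q∣ (a′ * b′) (b - a) ⟩
      ∣ a′ * b′ ∣ * ∣ b - a ∣              ≡⟨ cong (_* ∣ b - a ∣) (ℚ.∣p*q∣≡∣p∣*∣q∣ a′ b′) ⟩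
      (∣ a′ ∣ * ∣ b′ ∣) * ∣ b - a ∣        ≤⟨ *-mono (0≤* (ℚ.0≤∣p∣ a′) (ℚ.0≤∣p∣ b′)) (ℚ.<⇒≤ 0<γ)
                                                (*-mono (ℚ.0≤∣p∣ a′) (ℚ.<⇒≤ 0<C) (below m M≤m) (below n M≤n))
                                                (ℚ.<⇒≤ (hx n m (ℕ.m⊔n≤o⇒n≤o M N q) (ℕ.m⊔n≤o⇒n≤o M N p))) ⟩
      (C * C) * γ                          <⟨ small ⟩
      ε                                    ∎
      where
      C : ℚ
      C = proj₁ (reciprocal 0<δ)
      0<C : 0ℚ ℚ.< C
      0<C = proj₁ (proj₂ (reciprocal 0<δ))
      δC≡1 : δ * C ≡ 1ℚ
      δC≡1 = proj₂ (proj₂ (reciprocal 0<δ))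
      γ : ℚ
      γ = proj₁ (shrink (C * C) 0<ε)
      0<γ : 0ℚ ℚ.< γ
      0<γ = proj₁ (proj₂ (shrink (C * C) 0<ε))
      small : (C * C) * γ ℚ.< ε
      small = proj₂ (proj₂ (shrink (C * C) 0<ε))
      N : ℕ
      N = proj₁ (cx 0<γ)
      hx : ∀ m n → N ℕ.≤ m → N ℕ.≤ n → ∣ x m - x n ∣ ℚ.< γ
      hx = proj₂ (cx 0<γ)
      far′ : ∀ n → M ℕ.≤ n → δ ≤ ∣ x n ∣
      far′ n M≤n = subst (λ a → δ ≤ ∣ a ∣) (ℚ.+-identityʳ (x n)) (far n M≤n)
      nz : ∀ n → M ℕ.≤ n → x n ≢ 0ℚ
      nz n M≤n xn≡0 = ℚ.<-irrefl refl (ℚ.<-≤-trans 0<δ (subst (λ a → δ ≤ ∣ a ∣) xn≡0 (far′ n M≤n)))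
      below : ∀ n → M ℕ.≤ n → ∣ inv (x n) ∣ ≤ C
      below n M≤n = begin
        ∣ inv (x n) ∣                        ≡⟨ ℚ.*-identityʳ ∣ inv (x n) ∣ ⟨
        ∣ inv (x n) ∣ * 1ℚ                   ≡⟨ cong (∣ inv (x n) ∣ *_) δC≡1 ⟨
        ∣ inv (x n) ∣ * (δ * C)              ≤⟨ *-monoˡ (ℚ.0≤∣p∣ (inv (x n))) (*-monoʳ (ℚ.<⇒≤ 0<C) (far′ n M≤n)) ⟩
        ∣ inv (x n) ∣ * (∣ x n ∣ * C)        ≡⟨ id-swap ∣ inv (x n) ∣ ∣ x n ∣ C ⟩
        (∣ x n ∣ * ∣ inv (x n) ∣) * C        ≡⟨ cong (_* C) (ℚ.∣p*q∣≡∣p∣*∣q∣ (x n) (inv (x n))) ⟨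
        ∣ x n * inv (x n) ∣ * C              ≡⟨ cong (λ a → ∣ a ∣ * C) (inv-inverse (nz n M≤n)) ⟩
        1ℚ * C                               ≡⟨ ℚ.*-identityˡ C ⟩
        C                                    ∎

-- ∑_{k<n} (-1)^k x^(2k+1) / (2k+1)!
sinTaylor : ℕ → ℚ → ℚ
sinTaylor zero    x = 0ℚ
sinTaylor (suc k) x = sinTaylor k x ℚ.+
  ((ℚ.- 1ℚ) ^ℚ k) ℚ.* ((x ^ℚ suc (2 ℕ.* k)) ℚ.* (+ 1 / (suc (2 ℕ.* k) !)) {{suc (2 ℕ.* k) ℕ.!≢0}})

module SineLemmas where

  open RationalLemmas
  open CauchyLemmas using (bounded; fromHalf)
  open import Data.Rational.Base using (_+_; _*_; _-_; -_; _≤_)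
  open ℚ.≤-Reasoning

  r! : ℕ → ℚ
  r! n = r (n !) {{n ℕ.!≢0}}

  r!≥0 : ∀ n → 0ℚ ≤ r! n
  r!≥0 n = ℚ.<⇒≤ (r>0 (n !) {{n ℕ.!≢0}})

  r!-suc : ∀ n → r! (suc n) ≡ r! n * r (suc n)
  r!-suc n = trans (r-* (suc n) (n !) {{_}} {{n ℕ.!≢0}} {{suc n ℕ.!≢0}}) (ℚ.*-comm (r (suc n)) (r! n))

  pow≥0 : ∀ {B} n → 0ℚ ≤ B → 0ℚ ≤ B ^ℚ n
  pow≥0 zero    0≤B = 0≤ι 1
  pow≥0 (suc n) 0≤B = 0≤* 0≤B (pow≥0 n 0≤B)

  pow-mono : ∀ {A B} n → 0ℚ ≤ A → A ≤ B → A ^ℚ n ≤ B ^ℚ n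
  pow-mono zero    0≤A A≤B = ℚ.≤-refl
  pow-mono (suc n) 0≤A A≤B = *-mono 0≤A (pow≥0 n (ℚ.≤-trans 0≤A A≤B)) A≤B (pow-mono n 0≤A A≤B)

  pow-abs : ∀ x n → ∣ x ^ℚ n ∣ ≡ ∣ x ∣ ^ℚ n
  pow-abs x zero    = refl
  pow-abs x (suc n) = trans (ℚ.∣p*q∣≡∣p∣*∣q∣ x (x ^ℚ n)) (cong (∣ x ∣ *_) (pow-abs x n))

  sign-abs : ∀ k y → ∣ ((- 1ℚ) ^ℚ k) * y ∣ ≡ ∣ y ∣
  sign-abs zero    y = cong ∣_∣ (ℚ.*-identityˡ y)
  sign-abs (suc k) y = trans (cong ∣_∣ (id-sign ((- 1ℚ) ^ℚ k) y))
    (trans (ℚ.∣-p∣≡∣p∣ (((- 1ℚ) ^ℚ k) * y)) (sign-abs k y))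

  pow-diff : ∀ {M a b} n → 1ℚ ≤ M → ∣ a ∣ ≤ M → ∣ b ∣ ≤ M →
             ∣ a ^ℚ n - b ^ℚ n ∣ ≤ ((M + M) ^ℚ n) * ∣ a - b ∣
  pow-diff {M} {a} {b} zero 1≤M ha hb =
    ℚ.≤-trans (ℚ.0≤∣p∣ (a - b)) (ℚ.≤-reflexive (sym (ℚ.*-identityˡ ∣ a - b ∣)))
  pow-diff {M} {a} {b} (suc n) 1≤M ha hb = begin
    ∣ a * p - b * q ∣                        ≡⟨ cong ∣_∣ (id-pow a b p q) ⟩
    ∣ a * (p - q) + q * (a - b) ∣            ≤⟨ ℚ.∣p+q∣≤∣p∣+∣q∣ (a * (p - q)) (q * (a - b)) ⟩
    ∣ a * (p - q) ∣ + ∣ q * (a - b) ∣        ≡⟨ cong₂ _+_ (ℚ.∣p*q∣≡∣p∣*∣q∣ a (p - q)) (ℚ.∣p*q∣≡∣p∣*∣q∣ q (a - b)) ⟩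
    ∣ a ∣ * ∣ p - q ∣ + ∣ q ∣ * d            ≤⟨ ℚ.+-mono-≤
                                                  (*-mono (ℚ.0≤∣p∣ a) (0≤* (pow≥0 n 0≤B) (ℚ.0≤∣p∣ (a - b))) ha (pow-diff n 1≤M ha hb))
                                                  (*-monoʳ (ℚ.0≤∣p∣ (a - b)) q≤) ⟩
    M * (P * d) + (M * P) * d                ≡⟨ id-double M P d ⟩
    ((M + M) * P) * d                        ∎
    where
    p q d P : ℚ
    p = a ^ℚ n
    q = b ^ℚ n
    d = ∣ a - b ∣
    P = (M + M) ^ℚ n
    0≤M : 0ℚ ≤ M
    0≤M = ℚ.≤-trans (0≤ι 1) 1≤M
    0≤B : 0ℚ ≤ M + M
    0≤B = 0≤+ 0≤M 0≤M
    q≤ : ∣ q ∣ ≤ M * P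
    q≤ = begin
      ∣ q ∣         ≡⟨ pow-abs b n ⟩
      ∣ b ∣ ^ℚ n    ≤⟨ pow-mono n (ℚ.0≤∣p∣ b) (ℚ.≤-trans hb (≤+ 0≤M)) ⟩
      P             ≡⟨ ℚ.*-identityˡ P ⟨
      1ℚ * P        ≤⟨ *-monoʳ (pow≥0 n 0≤B) 1≤M ⟩
      M * P         ∎

  e : ℚ → ℕ → ℚ
  e B j = (B ^ℚ suc j) * r! (suc j)

  t : ℚ → ℕ → ℚ
  t B k = e B (2 ℕ.* k)

  U : ℚ → ℕ → ℚ
  U B zero    = 0ℚ
  U B (suc k) = U B k + t B k

  V : ℚ → ℕ → ℚ
  V B k = U B k + (t B k + t B k)

  e≥0 : ∀ {B} j → 0ℚ ≤ B → 0ℚ ≤ e B j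
  e≥0 j 0≤B = 0≤* (pow≥0 (suc j) 0≤B) (r!≥0 (suc j))

  e-step : ∀ B j → e B (2 ℕ.+ j) ≡ e B j * ((B * r (2 ℕ.+ j)) * (B * r (3 ℕ.+ j)))
  e-step B j = trans
    (cong ((B ^ℚ (3 ℕ.+ j)) *_) (trans (r!-suc (2 ℕ.+ j)) (cong (_* r (3 ℕ.+ j)) (r!-suc (1 ℕ.+ j)))))
    (id-ratio B (B ^ℚ suc j) (r! (suc j)) (r (2 ℕ.+ j)) (r (3 ℕ.+ j)))

  t-half : ∀ {B} k → 0ℚ ≤ B → B ≤ ι k → t B (suc k) ≤ ½ * t B k
  t-half {B} k 0≤B B≤k = begin
    e B (2 ℕ.* suc k)   ≡⟨ cong (e B) (ℕ.*-suc 2 k) ⟩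
    e B (2 ℕ.+ j)       ≡⟨ e-step B j ⟩
    e B j * ((B * r (2 ℕ.+ j)) * (B * r (3 ℕ.+ j)))
      ≤⟨ *-monoˡ (e≥0 j 0≤B) (*-mono (0≤* 0≤B (ℚ.<⇒≤ (r>0 (2 ℕ.+ j)))) (0≤ι 1) first second) ⟩
    e B j * (½ * 1ℚ)    ≡⟨ id-half (e B j) ⟩
    ½ * e B j           ∎
    where
    j : ℕ
    j = 2 ℕ.* k
    k+k≤j : k ℕ.+ k ℕ.≤ j
    k+k≤j = ℕ.≤-reflexive (cong (k ℕ.+_) (sym (ℕ.+-identityʳ k)))
    first : B * r (2 ℕ.+ j) ≤ ½
    first = *r≤ B ½ (2 ℕ.+ j) (begin
      B                    ≤⟨ B≤k ⟩
      ι k                  ≡⟨ id-twice (ι k) ⟨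
      (ι k + ι k) * ½      ≡⟨ cong (_* ½) (ι-+ k k) ⟨
      ι (k ℕ.+ k) * ½      ≤⟨ *-monoʳ (ℚ.<⇒≤ (ℚ.positive⁻¹ ½)) (ι-mono (ℕ.≤-trans k+k≤j (ℕ.m≤n+m j 2))) ⟩
      ι (2 ℕ.+ j) * ½      ∎)
    second : B * r (3 ℕ.+ j) ≤ 1ℚ
    second = *r≤ B 1ℚ (3 ℕ.+ j) (begin
      B                    ≤⟨ B≤k ⟩
      ι k                  ≤⟨ ι-mono (ℕ.≤-trans (ℕ.m≤m+n k k) (ℕ.≤-trans k+k≤j (ℕ.m≤n+m j 3))) ⟩
      ι (3 ℕ.+ j)          ≡⟨ ℚ.*-identityʳ (ι (3 ℕ.+ j)) ⟨
      ι (3 ℕ.+ j) * 1ℚ     ∎)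

  t-decay : ∀ {B K} i → 0ℚ ≤ B → B ≤ ι K → t B (i ℕ.+ K) ≤ t B K * r (suc i)
  t-decay {B} {K} zero    0≤B B≤K = ℚ.≤-reflexive (sym (ℚ.*-identityʳ (t B K)))
  t-decay {B} {K} (suc i) 0≤B B≤K = begin
    t B (suc (i ℕ.+ K))             ≤⟨ t-half (i ℕ.+ K) 0≤B (ℚ.≤-trans B≤K (ι-mono (ℕ.m≤n+m K i))) ⟩
    ½ * t B (i ℕ.+ K)               ≤⟨ *-monoˡ (ℚ.<⇒≤ (ℚ.positive⁻¹ ½)) (t-decay i 0≤B B≤K) ⟩
    ½ * (t B K * r (suc i))         ≡⟨ id-assoc ½ (t B K) (r (suc i)) ⟩
    t B K * (½ * r (suc i))         ≤⟨ *-monoˡ (e≥0 (2 ℕ.* K) 0≤B) (½r≤r i) ⟩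
    t B K * r (suc (suc i))         ∎

  V-decreasing : ∀ {B K} i → 0ℚ ≤ B → B ≤ ι K → V B (i ℕ.+ K) ≤ V B K
  V-decreasing {B} {K} zero    0≤B B≤K = ℚ.≤-refl
  V-decreasing {B} {K} (suc i) 0≤B B≤K = begin
    (U B n + t B n) + (t B (suc n) + t B (suc n))
      ≤⟨ ℚ.+-monoʳ-≤ (U B n + t B n) (ℚ.+-mono-≤ half half) ⟩
    (U B n + t B n) + (½ * t B n + ½ * t B n)
      ≡⟨ cong (λ s → (U B n + t B n) + s) (½+½ (t B n)) ⟩
    (U B n + t B n) + t B n
      ≡⟨ ℚ.+-assoc (U B n) (t B n) (t B n) ⟩
    V B n
      ≤⟨ V-decreasing i 0≤B B≤K ⟩
    V B K ∎
    where
    n : ℕ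
    n = i ℕ.+ K
    half : t B (suc n) ≤ ½ * t B n
    half = t-half n 0≤B (ℚ.≤-trans B≤K (ι-mono (ℕ.m≤n+m K i)))

  U≤V : ∀ {B} n → 0ℚ ≤ B → U B n ≤ V B n
  U≤V n 0≤B = ≤+ (0≤+ (e≥0 (2 ℕ.* n) 0≤B) (e≥0 (2 ℕ.* n) 0≤B))

  term : ℕ → ℚ → ℚ
  term k x = ((- 1ℚ) ^ℚ k) * ((x ^ℚ suc (2 ℕ.* k)) * r! (suc (2 ℕ.* k)))

  term-bound : ∀ {B x} k → ∣ x ∣ ≤ B → ∣ term k x ∣ ≤ t B k
  term-bound {B} {x} k hx = begin
    ∣ term k x ∣                           ≡⟨ sign-abs k ((x ^ℚ suc j) * r! (suc j)) ⟩
    ∣ (x ^ℚ suc j) * r! (suc j) ∣          ≡⟨ ℚ.∣p*q∣≡∣p∣*∣q∣ (x ^ℚ suc j) (r! (suc j)) ⟩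
    ∣ x ^ℚ suc j ∣ * ∣ r! (suc j) ∣        ≡⟨ cong₂ _*_ (pow-abs x (suc j)) (ℚ.0≤p⇒∣p∣≡p (r!≥0 (suc j))) ⟩
    (∣ x ∣ ^ℚ suc j) * r! (suc j)          ≤⟨ *-monoʳ (r!≥0 (suc j)) (pow-mono (suc j) (ℚ.0≤∣p∣ x) hx) ⟩
    (B ^ℚ suc j) * r! (suc j)              ∎
    where
    j : ℕ
    j = 2 ℕ.* k

  tail : ∀ {B x} n i → ∣ x ∣ ≤ B → ∣ sinTaylor (i ℕ.+ n) x - sinTaylor n x ∣ + U B n ≤ U B (i ℕ.+ n)
  tail {B} {x} n zero hx = ℚ.≤-reflexive
    (trans (cong (λ d → ∣ d ∣ + U B n) (ℚ.+-inverseʳ (sinTaylor n x))) (ℚ.+-identityˡ (U B n)))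
  tail {B} {x} n (suc i) hx = begin
    ∣ (S + term k x) - S′ ∣ + U B n      ≡⟨ cong (λ d → ∣ d ∣ + U B n) (id-diffₗ S (term k x) S′) ⟩
    ∣ (S - S′) + term k x ∣ + U B n      ≤⟨ ℚ.+-monoˡ-≤ (U B n) (ℚ.∣p+q∣≤∣p∣+∣q∣ (S - S′) (term k x)) ⟩
    (D + T) + U B n                      ≡⟨ ℚ.+-assoc D T (U B n) ⟩
    D + (T + U B n)                      ≡⟨ cong (λ s → D + s) (ℚ.+-comm T (U B n)) ⟩
    D + (U B n + T)                      ≡⟨ ℚ.+-assoc D (U B n) T ⟨
    (D + U B n) + T                      ≤⟨ ℚ.+-mono-≤ (tail n i hx) (term-bound k hx) ⟩
    U B k + t B k                        ∎
    where
    k : ℕ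
    k = i ℕ.+ n
    S S′ D T : ℚ
    S  = sinTaylor k x
    S′ = sinTaylor n x
    D  = ∣ S - S′ ∣
    T  = ∣ term k x ∣

  lipschitz : ∀ {M a b} n → 1ℚ ≤ M → ∣ a ∣ ≤ M → ∣ b ∣ ≤ M →
              ∣ sinTaylor n a - sinTaylor n b ∣ ≤ U (M + M) n * ∣ a - b ∣
  lipschitz {M} {a} {b} zero    1≤M ha hb = ℚ.≤-reflexive (sym (ℚ.*-zeroˡ ∣ a - b ∣))
  lipschitz {M} {a} {b} (suc k) 1≤M ha hb = begin
    ∣ (sinTaylor k a + term k a) - (sinTaylor k b + term k b) ∣
      ≡⟨ cong ∣_∣ (id-plus (sinTaylor k a) (term k a) (sinTaylor k b) (term k b)) ⟩
    ∣ (sinTaylor k a - sinTaylor k b) + (term k a - term k b) ∣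
      ≤⟨ ℚ.∣p+q∣≤∣p∣+∣q∣ (sinTaylor k a - sinTaylor k b) (term k a - term k b) ⟩
    ∣ sinTaylor k a - sinTaylor k b ∣ + ∣ term k a - term k b ∣
      ≤⟨ ℚ.+-mono-≤ (lipschitz k 1≤M ha hb) step ⟩
    U B k * d + t B k * d
      ≡⟨ id-dist (U B k) (t B k) d ⟩
    (U B k + t B k) * d ∎
    where
    j : ℕ
    j = suc (2 ℕ.* k)
    B d : ℚ
    B = M + M
    d = ∣ a - b ∣
    step : ∣ term k a - term k b ∣ ≤ t B k * d
    step = begin
      ∣ term k a - term k b ∣                                    ≡⟨ cong ∣_∣ (id-term ((- 1ℚ) ^ℚ k) (a ^ℚ j) (b ^ℚ j) (r! j)) ⟩
      ∣ ((- 1ℚ) ^ℚ k) * ((a ^ℚ j - b ^ℚ j) * r! j) ∣             ≡⟨ sign-abs k ((a ^ℚ j - b ^ℚ j) * r! j) ⟩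
      ∣ (a ^ℚ j - b ^ℚ j) * r! j ∣                               ≡⟨ ℚ.∣p*q∣≡∣p∣*∣q∣ (a ^ℚ j - b ^ℚ j) (r! j) ⟩
      ∣ a ^ℚ j - b ^ℚ j ∣ * ∣ r! j ∣                             ≡⟨ cong (∣ a ^ℚ j - b ^ℚ j ∣ *_) (ℚ.0≤p⇒∣p∣≡p (r!≥0 j)) ⟩
      ∣ a ^ℚ j - b ^ℚ j ∣ * r! j                                 ≤⟨ *-monoʳ (r!≥0 j) (pow-diff j 1≤M ha hb) ⟩
      ((B ^ℚ j) * d) * r! j                                      ≡⟨ id-last (B ^ℚ j) d (r! j) ⟩
      ((B ^ℚ j) * r! j) * d                                      ∎

  abstract

    sinCauchy : ∀ {x} → IsCauchy x → IsCauchy (λ n → sinTaylor n (x n))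
    sinCauchy {x} cx = fromHalf {λ n → sinTaylor n (x n)} close
      where
      M : ℚ
      M = proj₁ (bounded {x} cx)
      1≤M : 1ℚ ≤ M
      1≤M = proj₁ (proj₂ (bounded {x} cx))
      x≤M : ∀ n → ∣ x n ∣ ≤ M
      x≤M = proj₂ (proj₂ (bounded {x} cx))
      B : ℚ
      B = M + M
      0≤M : 0ℚ ≤ M
      0≤M = ℚ.≤-trans (0≤ι 1) 1≤M
      0≤B : 0ℚ ≤ B
      0≤B = 0≤+ 0≤M 0≤M
      K : ℕ
      K = proj₁ (bound B)
      B≤K : B ≤ ι K
      B≤K = proj₂ (bound B)

      close : ∀ {ε} → 0ℚ ℚ.< ε →
              ∃[ N ] (∀ n → N ℕ.≤ n → ∣ sinTaylor n (x n) - sinTaylor N (x N) ∣ ℚ.< ε)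
      close {ε} 0<ε = N , λ n N≤n → begin-strict
        ∣ sinTaylor n (x n) - sinTaylor N (x N) ∣
          ≤⟨ triangle (sinTaylor n (x n)) (sinTaylor N (x n)) (sinTaylor N (x N)) ⟩
        ∣ sinTaylor n (x n) - sinTaylor N (x n) ∣ + ∣ sinTaylor N (x n) - sinTaylor N (x N) ∣
          <⟨ ℚ.+-mono-< (left n N≤n) (right n N≤n) ⟩
        ½ * ε + ½ * ε
          ≡⟨ ½+½ ε ⟩
        ε ∎
        where
        decay : ∃[ I ] (∀ i → I ℕ.≤ i → (t B K + t B K) * r (suc i) ℚ.< ½ * ε)
        decay = archimedes (t B K + t B K) (½> 0<ε)
        slope : Σ ℚ λ δ → 0ℚ ℚ.< δ × V B K * δ ℚ.< ½ * ε
        slope = shrink (V B K) (½> 0<ε)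
        δ : ℚ
        δ = proj₁ slope
        near : ∃[ J ] (∀ m n → J ℕ.≤ m → J ℕ.≤ n → ∣ x m - x n ∣ ℚ.< δ)
        near = cx (proj₁ (proj₂ slope))
        I J N : ℕ
        I = proj₁ decay
        J = proj₁ near
        N = (I ℕ.⊔ J) ℕ.+ K
        B≤N : B ≤ ι N
        B≤N = ℚ.≤-trans B≤K (ι-mono (ℕ.m≤n+m K (I ℕ.⊔ J)))
        J≤N : J ℕ.≤ N
        J≤N = ℕ.≤-trans (ℕ.m≤n⊔m I J) (ℕ.m≤m+n (I ℕ.⊔ J) K)
        0≤V : 0ℚ ≤ V B K
        0≤V = ℚ.≤-trans (0≤U K) (U≤V K 0≤B)
          where
          0≤U : ∀ n → 0ℚ ≤ U B n
          0≤U zero    = ℚ.≤-refl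
          0≤U (suc n) = 0≤+ (0≤U n) (e≥0 (2 ℕ.* n) 0≤B)

        left : ∀ n → N ℕ.≤ n → ∣ sinTaylor n (x n) - sinTaylor N (x n) ∣ ℚ.< ½ * ε
        left n N≤n = begin-strict
          ∣ sinTaylor n (x n) - sinTaylor N (x n) ∣     ≤⟨ cancel (U B N) (begin
            ∣ sinTaylor n (x n) - sinTaylor N (x n) ∣ + U B N   ≡⟨ cong (λ m → ∣ sinTaylor m (x n) - sinTaylor N (x n) ∣ + U B N) n≡ ⟩
            ∣ sinTaylor (i ℕ.+ N) (x n) - sinTaylor N (x n) ∣ + U B N
                                                                ≤⟨ tail N i (ℚ.≤-trans (x≤M n) (≤+ 0≤M)) ⟩
            U B (i ℕ.+ N)                                       ≤⟨ U≤V (i ℕ.+ N) 0≤B ⟩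
            V B (i ℕ.+ N)                                       ≤⟨ V-decreasing i 0≤B B≤N ⟩
            U B N + (t B N + t B N)                             ≡⟨ ℚ.+-comm (U B N) (t B N + t B N) ⟩
            (t B N + t B N) + U B N                             ∎) ⟩
          t B N + t B N                                 ≤⟨ ℚ.+-mono-≤ small small ⟩
          t B K * ρ + t B K * ρ                         ≡⟨ id-dist (t B K) (t B K) ρ ⟩
          (t B K + t B K) * ρ                           <⟨ proj₂ decay (I ℕ.⊔ J) (ℕ.m≤m⊔n I J) ⟩
          ½ * ε                                         ∎
          where
          i : ℕ
          i = n ℕ.∸ N
          n≡ : n ≡ i ℕ.+ N
          n≡ = sym (ℕ.m∸n+n≡m N≤n)
          ρ : ℚ
          ρ = r (suc (I ℕ.⊔ J))
          small : t B N ≤ t B K * ρ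
          small = t-decay (I ℕ.⊔ J) 0≤B B≤K
          cancel : ∀ {a b} c → a + c ≤ b + c → a ≤ b
          cancel {a} {b} c p = subst₂ _≤_ (id-cancel a c) (id-cancel b c) (ℚ.+-monoˡ-≤ (- c) p)

        right : ∀ n → N ℕ.≤ n → ∣ sinTaylor N (x n) - sinTaylor N (x N) ∣ ℚ.< ½ * ε
        right n N≤n = begin-strict
          ∣ sinTaylor N (x n) - sinTaylor N (x N) ∣     ≤⟨ lipschitz N 1≤M (x≤M n) (x≤M N) ⟩
          U B N * ∣ x n - x N ∣                         ≤⟨ *-monoʳ (ℚ.0≤∣p∣ (x n - x N)) (ℚ.≤-trans (U≤V N 0≤B) (V-decreasing (I ℕ.⊔ J) 0≤B B≤K)) ⟩
          V B K * ∣ x n - x N ∣                         ≤⟨ *-monoˡ 0≤V (ℚ.<⇒≤ (proj₂ near n N (ℕ.≤-trans J≤N N≤n) J≤N)) ⟩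
          V B K * δ                                     <⟨ proj₂ (proj₂ slope) ⟩
          ½ * ε                                         ∎

infix  8 -_
infixl 7 _*_
infixl 6 _+_

fromℚ : ℚ → ℝ
fromℚ q = mkℝ (λ _ → q) (CauchyLemmas.constant q)

fromℕ : ℕ → ℝ
fromℕ n = fromℚ (+ n / 1)

_+_ : ℝ → ℝ → ℝ
x + y = mkℝ (λ n → seq x n ℚ.+ seq y n) (CauchyLemmas.plus {seq x} {seq y} (cauchy x) (cauchy y))

-_ : ℝ → ℝ
- x = mkℝ (λ n → ℚ.- seq x n) (CauchyLemmas.minus {seq x} (cauchy x))

_*_ : ℝ → ℝ → ℝ
x * y = mkℝ (λ n → seq x n ℚ.* seq y n) (CauchyLemmas.times {seq x} {seq y} (cauchy x) (cauchy y))

0ℝ 1ℝ : ℝ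
0ℝ = fromℚ 0ℚ
1ℝ = fromℚ 1ℚ

-- CauchyLemmas.inv sends 0 to 0, but only finitely many terms can be affected.
inverse : (x : ℝ) → x # 0ℝ → ℝ
inverse x (mk# δ 0<δ x-far) = mkℝ (λ n → CauchyLemmas.inv (seq x n)) (CauchyLemmas.inverse {seq x} (cauchy x) 0<δ x-far)

ℝ-rawRing : RawRing 0ℓ 0ℓ
ℝ-rawRing = record
  { Carrier = ℝ ; _≈_ = _≃_ ; _+_ = _+_ ; _*_ = _*_ ; -_ = -_ ; 0# = 0ℝ ; 1# = 1ℝ }

open RawSemiringDefinitions (RawRing.rawSemiring ℝ-rawRing) public using (_^_)

sumℝ : List ℝ → ℝ
sumℝ = List.foldr _+_ 0ℝ

-- The Taylor polynomials converge locally uniformly and are equicontinuous on bounded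
-- sets, so this diagonal sequence represents the sum of the power series at x.
sin : ℝ → ℝ
sin x = mkℝ (λ n → sinTaylor n (seq x n)) (SineLemmas.sinCauchy {seq x} (cauchy x))

-- π is the least positive zero of the sine.
record IsPi (π : ℝ) : Set where
  field
    π-pos   : 0ℝ < π
    sin-π   : sin π ≃ 0ℝ
    π-least : ∀ x → 0ℝ < x → x < π → sin x # 0ℝ

-- The index i stands for the residue 1 + i, so that Fin (pred m) enumerates (ℤ/mℤ) ∖ {0}.
Residue : ℕ → Set
Residue m = Fin (pred m)

rep : ∀ {n} → Fin n → ℕ
rep i = suc (toℕ i)

angle : ℝ → (m : ℕ) .{{_ : ℕ.NonZero m}} → Residue m → ℝ
angle π m j = π * fromℚ (+ rep j / m)

module ApartLemmas where

  open RationalLemmas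

  abstract

    sin-angle#0 : ∀ {π} → IsPi π → (m : ℕ) .{{_ : ℕ.NonZero m}} (j : Residue m) → sin (angle π m j) # 0ℝ
    sin-angle#0 {π} isPi m@(suc _) j = IsPi.π-least isPi (angle π m j)
      (mk< (δ ℚ.* q) (0<* 0<δ 0<q) (N , λ n N≤n →
        ℚ.≤-trans (*-monoʳ (ℚ.<⇒≤ 0<q) (far n N≤n)) (ℚ.≤-reflexive (id-angle₁ (seq π n) q))))
      (mk< (δ ℚ.* (1ℚ ℚ.- q)) (0<* 0<δ (0<- q<1)) (N , λ n N≤n →
        ℚ.≤-trans (*-monoʳ (ℚ.<⇒≤ (0<- q<1)) (far n N≤n)) (ℚ.≤-reflexive (id-angle₂ (seq π n) q))))
      where
      δ : ℚ
      δ = _<_.gap (IsPi.π-pos isPi)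
      0<δ : 0ℚ ℚ.< δ
      0<δ = _<_.gap>0 (IsPi.π-pos isPi)
      N : ℕ
      N = proj₁ (_<_.from (IsPi.π-pos isPi))
      far : ∀ n → N ℕ.≤ n → δ ℚ.≤ seq π n ℚ.- 0ℚ
      far = proj₂ (_<_.from (IsPi.π-pos isPi))
      q : ℚ
      q = + rep j / m
      0<q : 0ℚ ℚ.< q
      0<q = cancel-< {c = ι m} (ι>0 m) (subst₂ ℚ._<_ (sym (ℚ.*-zeroʳ (ι m))) (sym (i/n (rep j) m)) (ι>0 (rep j)))
      q<1 : q ℚ.< 1ℚ
      q<1 = cancel-< {c = ι m} (ι>0 m) (subst₂ ℚ._<_ (sym (i/n (rep j) m)) (sym (ℚ.*-identityʳ (ι m)))
        (ℚ.<-≤-trans (ι< (rep j)) (ι-mono (s≤s (toℕ<n j)))))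

    *-#0 : ∀ {x y} → x # 0ℝ → y # 0ℝ → x * y # 0ℝ
    *-#0 {x} {y} (mk# δ 0<δ (M , hx)) (mk# γ 0<γ (N , hy)) = mk# (δ ℚ.* γ) (0<* 0<δ 0<γ) (M ℕ.⊔ N , λ n p →
      ℚ.≤-trans
        (*-mono (ℚ.<⇒≤ 0<δ) (ℚ.0≤∣p∣ (seq y n ℚ.- 0ℚ)) (hx n (ℕ.m⊔n≤o⇒m≤o M N p)) (hy n (ℕ.m⊔n≤o⇒n≤o M N p)))
        (ℚ.≤-reflexive (trans (sym (ℚ.∣p*q∣≡∣p∣*∣q∣ (seq x n ℚ.- 0ℚ) (seq y n ℚ.- 0ℚ)))
          (cong ∣_∣ (sym (id-minus0 (seq x n) (seq y n)))))))

    8#0 : fromℕ 8 # 0ℝ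
    8#0 = mk# (+ 8 / 1) (ι>0 8) (0 , λ _ _ → ℚ.≤-refl)

module _ {π : ℝ} (isPi : IsPi π) (m : ℕ) .{{_ : ℕ.NonZero m}} where

  sinProduct : Residue m → Residue m → Residue m → ℝ
  sinProduct j l k = fromℕ 8 * sin (angle π m j) * sin (angle π m l) * sin (angle π m k)

  abstract

    sinProduct#0 : ∀ j l k → sinProduct j l k # 0ℝ
    sinProduct#0 j l k = *-#0 (*-#0 (*-#0 8#0 (s j)) (s l)) (s k)
      where
      open ApartLemmas
      s : ∀ i → sin (angle π m i) # 0ℝ
      s = sin-angle#0 isPi m

  triples : List (Residue m × Residue m × Residue m)
  triples = List.filter (λ (j , l , k) → m ∣? rep j ℕ.+ rep l ℕ.+ rep k)
    (List.cartesianProduct (List.allFin _) (List.cartesianProduct (List.allFin _) (List.allFin _)))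

  -- verlinde isPi m n is V_n(m); x^(-2n) is read as (x⁻¹)^(2n).
  verlinde : ℕ → ℝ
  verlinde n = fromℕ (3 ℕ.^ n ℕ.* m ℕ.^ (2 ℕ.* n)) *
    sumℝ (List.map (λ (j , l , k) → inverse (sinProduct j l k) (sinProduct#0 j l k) ^ (2 ℕ.* n)) triples)

fib : ℕ → ℕ
fib 0             = 0
fib 1             = 1
fib (suc (suc n)) = fib (suc n) ℕ.+ fib n

{-# OPTIONS --safe #-}

-- The real and imaginary parts of (ix)ᵏ/k! satisfy the addition formulas as formal convolutions, and
-- |∑_{i<n} fᵢ · ∑_{j<n} gⱼ − ∑_{k<n} (f ∗ g)ₖ| is dominated by a remainder of the exponential series, so
-- the Taylor sequences of sine and cosine satisfy the addition formulas up to null sequences.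
-- For θ = π/5, A = sin² θ and B = sin² 2θ this gives sin 5θ = sin θ (16A² − 20A + 5), so the second
-- factor vanishes, whence 4A + 4B = 5 = 16AB.  Six of the twelve summands have
-- (8 sin sin sin)² = 64A²B = 20A = 25/(4B) and the other six have 64AB² = 25/(4A), so that
-- V_n(5) = 6·3ⁿ((4A)ⁿ + (4B)ⁿ).  The power sums p_n satisfy p_{n+2} = 5p_{n+1} − 5p_n, as do
-- 5^{k+1}F_{2k+1} at n = 2k + 1 and 5^{k+1}(F_{2k+1} + F_{2k+3}) at n = 2k + 2.

module Submission where

open import Algebra.Bundles using (CommutativeRing)
import Algebra.Definitions.RawSemiring as RawSemiringDefinitions
import Algebra.Properties.CommutativeSemiring.Exp
import Algebra.Properties.Semiring.Exp
import Algebra.Solver.Ring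
open import Algebra.Solver.Ring.AlmostCommutativeRing using (fromCommutativeRing; _-Raw-AlmostCommutative⟶_)
open import Data.Fin.Patterns using (0F; 1F; 2F; 3F)
open import Data.List.Base as List using (List; []; _∷_)
open import Data.List.Relation.Binary.Pointwise.Base using (Pointwise; []; _∷_)
open import Data.Maybe.Base using (Maybe; just; nothing)
open import Data.Nat.Base as ℕ using (ℕ; zero; suc; s≤s)
open import Data.Nat.Divisibility using (divides)
open import Data.Nat.DivMod using (m*n/n≡m)
import Data.Nat.Properties as ℕ
import Data.Nat.Solver as ℕ
open import Data.Product.Base using (Σ; _×_; _,_; proj₁; proj₂; ∃-syntax)
open import Data.Rational.Base as ℚ using (ℚ; 0ℚ; 1ℚ; ½; ∣_∣)
import Data.Rational.Properties as ℚ
import Data.Rational.Solver as ℚ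
open import Data.Sum.Base using (_⊎_; inj₁; inj₂)
open import Function.Base using (_∘_)
open import Level using (0ℓ)
open import Relation.Binary.PropositionalEquality as ≡ using (_≡_)
open import Relation.Nullary using (yes; no; contradiction)

open import Defs as Defs using
  ( ℝ; IsPi; IsCauchy; _≃_; mk≃; _#_; mk#; 0ℝ; inverse; fromℕ; sinTaylor; sumℝ; angle
  ; Residue; triples; sinProduct; sinProduct#0; verlinde; fib
  ; module RationalLemmas; module CauchyLemmas; module SineLemmas )

-- The obstacle is that `sin` is only a diagonal sequence: the n-th Taylor polynomial at the n-th
-- rational approximation. Identities are therefore proved in the ring of bounded rational sequences
-- modulo null sequences. Cosines live there as truncated sums, and `≈` between images of reals is
-- `≃`. Each estimate holds for every rational argument below a common bound, so a moving argument
-- does no harm. This ring has zero divisors, so sin θ is cancelled from sin 5θ = 0 by an explicit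
-- inverse, which exists because π is the least positive zero.
--
-- The value A = (5 - √5)/8 is never computed: only the symmetric functions of 4A and 4B enter. With
-- φ the golden ratio and ψ = -1/φ, these numbers are √5/φ and √5φ, so (4A)ⁿ + (4B)ⁿ = 5^(n/2)(φⁿ +
-- φ⁻ⁿ). Since φ⁻ⁿ = (-1)ⁿψⁿ, the bracket is √5 Fₙ for odd n and the Lucas number Fₙ₋₁ + Fₙ₊₁ for
-- even n, whence the two cases of the theorem.

module Series where

  open RationalLemmas
  open ≡ using (refl; sym; trans; cong; cong₂; subst)
  open RawSemiringDefinitions ℚ.+-*-rawSemiring using () renaming (_^_ to _^ℚ_)
  open import Data.Rational.Base using (_+_; _*_; _-_; -_; _≤_)
  open ℚ.≤-Reasoning
  private module Eq = ≡.≡-Reasoning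
  open ℚ.+-*-Solver using (solve; _:+_; _:*_; _:-_; :-_; _:=_; con)

  -- Formal power series: Cauchy products and derivatives

  ∑ : (ℕ → ℚ) → ℕ → ℚ
  ∑ f zero    = 0ℚ
  ∑ f (suc n) = ∑ f n + f n

  -- The Cauchy product ∑_{i ≤ k} f(i) g(k - i), unfolded from the left. Only f is shifted, so
  -- inductions on k keep f general and g fixed.
  conv : (ℕ → ℚ) → (ℕ → ℚ) → ℕ → ℚ
  conv f g zero    = f 0 * g 0
  conv f g (suc k) = f 0 * g (suc k) + conv (f ∘ suc) g k

  conv-congˡ : ∀ {f f′} g k → (∀ i → f i ≡ f′ i) → conv f g k ≡ conv f′ g k
  conv-congˡ g zero    f≡ = cong (_* g 0) (f≡ 0)
  conv-congˡ g (suc k) f≡ = cong₂ _+_ (cong (_* g (suc k)) (f≡ 0)) (conv-congˡ g k (f≡ ∘ suc))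

  conv-congʳ : ∀ f {g g′} k → (∀ i → g i ≡ g′ i) → conv f g k ≡ conv f g′ k
  conv-congʳ f zero    g≡ = cong (f 0 *_) (g≡ 0)
  conv-congʳ f (suc k) g≡ = cong₂ _+_ (cong (f 0 *_) (g≡ (suc k))) (conv-congʳ (f ∘ suc) k g≡)

  conv-+ˡ : ∀ f f′ g k → conv (λ i → f i + f′ i) g k ≡ conv f g k + conv f′ g k
  conv-+ˡ f f′ g zero    = ℚ.*-distribʳ-+ (g 0) (f 0) (f′ 0)
  conv-+ˡ f f′ g (suc k) = trans
    (cong ((f 0 + f′ 0) * g (suc k) +_) (conv-+ˡ (f ∘ suc) (f′ ∘ suc) g k))
    (solve 5 (λ a b c u v → (a :+ b) :* c :+ (u :+ v) := (a :* c :+ u) :+ (b :* c :+ v)) refl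
      (f 0) (f′ 0) (g (suc k)) (conv (f ∘ suc) g k) (conv (f′ ∘ suc) g k))

  conv-*ˡ : ∀ x f g k → conv (λ i → x * f i) g k ≡ x * conv f g k
  conv-*ˡ x f g zero    = ℚ.*-assoc x (f 0) (g 0)
  conv-*ˡ x f g (suc k) = trans
    (cong (x * f 0 * g (suc k) +_) (conv-*ˡ x (f ∘ suc) g k))
    (solve 4 (λ x a c u → x :* a :* c :+ x :* u := x :* (a :* c :+ u)) refl
      x (f 0) (g (suc k)) (conv (f ∘ suc) g k))

  conv-*ʳ : ∀ x f g k → conv f (λ i → x * g i) k ≡ x * conv f g k
  conv-*ʳ x f g zero    = id-assoc (f 0) x (g 0)
  conv-*ʳ x f g (suc k) = trans
    (cong (f 0 * (x * g (suc k)) +_) (conv-*ʳ x (f ∘ suc) g k))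
    (solve 4 (λ x a c u → a :* (x :* c) :+ x :* u := x :* (a :* c :+ u)) refl
      x (f 0) (g (suc k)) (conv (f ∘ suc) g k))

  -- The coefficients of the derivative of ∑ f(k) tᵏ.
  D : (ℕ → ℚ) → ℕ → ℚ
  D f k = ι (suc k) * f (suc k)

  ι-suc : ∀ n → ι (suc n) ≡ 1ℚ + ι n
  ι-suc = ι-+ 1

  -- Write f(t) = f(0) + t h(t), so that f′ = h + t h′. Splitting the factor k + 2 as 1 + (k + 1)
  -- separates the contribution of h from that of the derivative of h g, to which the induction
  -- hypothesis applies.
  leibniz : ∀ f g k → D (conv f g) k ≡ conv (D f) g k + conv f (D g) k
  leibniz f g zero =
    solve 4 (λ a b c d → con 1ℚ :* (a :* d :+ b :* c) := (con 1ℚ :* b) :* c :+ a :* (con 1ℚ :* d)) refl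
      (f 0) (f 1) (g 0) (g 1)
  leibniz f g (suc k) = Eq.begin
    ι (2 ℕ.+ k) * (f 0 * g (2 ℕ.+ k) + (f 1 * g (suc k) + C))
      Eq.≡⟨ cong (_* (f 0 * g (2 ℕ.+ k) + (f 1 * g (suc k) + C))) (ι-suc (suc k)) ⟩
    (1ℚ + n) * (f 0 * g (2 ℕ.+ k) + (f 1 * g (suc k) + C))
      Eq.≡⟨ solve 6 (λ n a b c d u → (con 1ℚ :+ n) :* (a :* d :+ (b :* c :+ u)) :=
             b :* c :+ u :+ (a :* ((con 1ℚ :+ n) :* d) :+ n :* (b :* c :+ u))) refl
             n (f 0) (f 1) (g (suc k)) (g (2 ℕ.+ k)) C ⟩
    f 1 * g (suc k) + C + (f 0 * ((1ℚ + n) * g (2 ℕ.+ k)) + D (conv (f ∘ suc) g) k)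
      Eq.≡⟨ cong₂ (λ m d → f 1 * g (suc k) + C + (f 0 * (m * g (2 ℕ.+ k)) + d))
             (sym (ι-suc (suc k))) (leibniz (f ∘ suc) g k) ⟩
    f 1 * g (suc k) + C + (f 0 * D g (suc k) + (conv (D (f ∘ suc)) g k + P))
      Eq.≡⟨ solve 6 (λ b c u d v w → b :* c :+ u :+ (d :+ (v :+ w)) := (con 1ℚ :* b) :* c :+ (u :+ v) :+ (d :+ w)) refl
             (f 1) (g (suc k)) C (f 0 * D g (suc k)) (conv (D (f ∘ suc)) g k) P ⟩
    D f 0 * g (suc k) + (C + conv (D (f ∘ suc)) g k) + (f 0 * D g (suc k) + P)
      Eq.≡⟨ cong (λ d → D f 0 * g (suc k) + d + (f 0 * D g (suc k) + P)) (Eq.begin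
             C + conv (D (f ∘ suc)) g k
               Eq.≡⟨ conv-+ˡ (f ∘ suc ∘ suc) (D (f ∘ suc)) g k ⟨
             conv (λ i → f (2 ℕ.+ i) + ι (suc i) * f (2 ℕ.+ i)) g k
               Eq.≡⟨ conv-congˡ g k (λ i → trans (solve 2 (λ a n → a :+ n :* a := (con 1ℚ :+ n) :* a) refl (f (2 ℕ.+ i)) (ι (suc i)))
                     (cong (_* f (2 ℕ.+ i)) (sym (ι-suc (suc i))))) ⟩
             conv (D f ∘ suc) g k Eq.∎) ⟩
    D f 0 * g (suc k) + conv (D f ∘ suc) g k + (f 0 * D g (suc k) + P) Eq.∎
    where
    n C P : ℚ
    n = ι (suc k)
    C = conv (f ∘ suc ∘ suc) g k
    P = conv (f ∘ suc) (D g) k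

  D-injective : ∀ {f g} k → D f k ≡ D g k → f (suc k) ≡ g (suc k)
  D-injective k = cancel-≡ (ι>0 (suc k))

  -- d x k = xᵏ/k!, and (i x)ᵏ/k! has real part c x k and imaginary part s x k.
  d c s : ℚ → ℕ → ℚ
  d x zero    = 1ℚ
  d x (suc k) = (x * d x k) * r (suc k)
  c x zero    = 1ℚ
  c x (suc k) = (- x * s x k) * r (suc k)
  s x zero    = 0ℚ
  s x (suc k) = (x * c x k) * r (suc k)

  ι*r : ∀ k x → ι (suc k) * (x * r (suc k)) ≡ x
  ι*r k x = trans (id-assoc (ι (suc k)) x (r (suc k))) (trans (cong (x *_) (i/n 1 (suc k))) (ℚ.*-identityʳ x))

  D-d : ∀ x k → D (d x) k ≡ x * d x k
  D-d x k = ι*r k (x * d x k)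

  D-c : ∀ x k → D (c x) k ≡ - x * s x k
  D-c x k = ι*r k (- x * s x k)

  D-s : ∀ x k → D (s x) k ≡ x * c x k
  D-s x k = ι*r k (x * c x k)

  leibniz-* : ∀ {f g} f′ g′ u v → (∀ i → D f i ≡ u * f′ i) → (∀ i → D g i ≡ v * g′ i) →
              ∀ k → D (conv f g) k ≡ u * conv f′ g k + v * conv f g′ k
  leibniz-* {f} {g} f′ g′ u v Df Dg k = trans (leibniz f g k) (cong₂ _+_
    (trans (conv-congˡ g k Df) (conv-*ˡ u f′ g k))
    (trans (conv-congʳ f k Dg) (conv-*ʳ v f g′ k)))

  -- The binomial theorem divided by k!. Both sides begin with 1 and solve h′ = (x + y) h, which
  -- determines each coefficient from the one before; no binomial coefficients occur.
  d-+ : ∀ x y k → conv (d x) (d y) k ≡ d (x + y) k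
  d-+ x y zero    = refl
  d-+ x y (suc k) = D-injective {conv (d x) (d y)} {d (x + y)} k (Eq.begin
    D (conv (d x) (d y)) k     Eq.≡⟨ leibniz-* (d x) (d y) x y (D-d x) (D-d y) k ⟩
    x * h + y * h              Eq.≡⟨ ℚ.*-distribʳ-+ h x y ⟨
    (x + y) * h                Eq.≡⟨ cong ((x + y) *_) (d-+ x y k) ⟩
    (x + y) * d (x + y) k      Eq.≡⟨ D-d (x + y) k ⟨
    D (d (x + y)) k            Eq.∎)
    where
    h : ℚ
    h = conv (d x) (d y) k

  -- The same uniqueness argument for the system c′ = -(x + y) s, s′ = (x + y) c. Each derivative
  -- involves the other function, hence the mutual induction.
  c-+ : ∀ x y k → conv (c x) (c y) k - conv (s x) (s y) k ≡ c (x + y) k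
  s-+ : ∀ x y k → conv (s x) (c y) k + conv (c x) (s y) k ≡ s (x + y) k
  c-+ x y zero    = refl
  c-+ x y (suc k) = D-injective {λ i → conv (c x) (c y) i - conv (s x) (s y) i} {c (x + y)} k (Eq.begin
    n * (conv (c x) (c y) (suc k) - conv (s x) (s y) (suc k))
      Eq.≡⟨ solve 3 (λ n a b → n :* (a :- b) := n :* a :- n :* b) refl n (conv (c x) (c y) (suc k)) (conv (s x) (s y) (suc k)) ⟩
    D (conv (c x) (c y)) k - D (conv (s x) (s y)) k
      Eq.≡⟨ cong₂ _-_ (leibniz-* (s x) (s y) (- x) (- y) (D-c x) (D-c y) k)
                     (leibniz-* (c x) (c y) x y (D-s x) (D-s y) k) ⟩
    (- x * conv (s x) (c y) k + - y * conv (c x) (s y) k) - (x * conv (c x) (s y) k + y * conv (s x) (c y) k)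
      Eq.≡⟨ solve 4 (λ x y a b → (:- x :* a :+ :- y :* b) :- (x :* b :+ y :* a) := :- (x :+ y) :* (a :+ b)) refl
             x y (conv (s x) (c y) k) (conv (c x) (s y) k) ⟩
    - (x + y) * (conv (s x) (c y) k + conv (c x) (s y) k)
      Eq.≡⟨ cong (- (x + y) *_) (s-+ x y k) ⟩
    - (x + y) * s (x + y) k
      Eq.≡⟨ D-c (x + y) k ⟨
    D (c (x + y)) k Eq.∎)
    where
    n : ℚ
    n = ι (suc k)
  s-+ x y zero    = refl
  s-+ x y (suc k) = D-injective {λ i → conv (s x) (c y) i + conv (c x) (s y) i} {s (x + y)} k (Eq.begin
    n * (conv (s x) (c y) (suc k) + conv (c x) (s y) (suc k))
      Eq.≡⟨ ℚ.*-distribˡ-+ n (conv (s x) (c y) (suc k)) (conv (c x) (s y) (suc k)) ⟩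
    D (conv (s x) (c y)) k + D (conv (c x) (s y)) k
      Eq.≡⟨ cong₂ _+_ (leibniz-* (c x) (s y) x (- y) (D-s x) (D-c y) k)
                     (leibniz-* (s x) (c y) (- x) y (D-c x) (D-s y) k) ⟩
    (x * conv (c x) (c y) k + - y * conv (s x) (s y) k) + (- x * conv (s x) (s y) k + y * conv (c x) (c y) k)
      Eq.≡⟨ solve 4 (λ x y a b → (x :* a :+ :- y :* b) :+ (:- x :* b :+ y :* a) := (x :+ y) :* (a :- b)) refl
             x y (conv (c x) (c y) k) (conv (s x) (s y) k) ⟩
    (x + y) * (conv (c x) (c y) k - conv (s x) (s y) k)
      Eq.≡⟨ cong ((x + y) *_) (c-+ x y k) ⟩
    (x + y) * c (x + y) k
      Eq.≡⟨ D-s (x + y) k ⟨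
    D (s (x + y)) k Eq.∎)
    where
    n : ℚ
    n = ι (suc k)

  c-neg : ∀ x k → c (- x) k ≡ c x k
  s-neg : ∀ x k → s (- x) k ≡ - s x k
  c-neg x zero    = refl
  c-neg x (suc k) = trans (cong (λ t → (- - x * t) * r (suc k)) (s-neg x k))
    (solve 3 (λ x t i → (:- (:- x) :* :- t) :* i := (:- x :* t) :* i) refl x (s x k) (r (suc k)))
  s-neg x zero    = refl
  s-neg x (suc k) = trans (cong (λ t → (- x * t) * r (suc k)) (c-neg x k))
    (solve 3 (λ x t i → (:- x :* t) :* i := :- ((x :* t) :* i)) refl x (c x k) (r (suc k)))

  -- Comparison with the Taylor polynomials of the sine

  pow : ℚ → ℕ → ℚ
  pow x k = (x ^ℚ k) * SineLemmas.r! k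

  pow-suc : ∀ x k → (x * pow x k) * r (suc k) ≡ pow x (suc k)
  pow-suc x k = trans
    (solve 4 (λ x p q i → (x :* (p :* q)) :* i := (x :* p) :* (q :* i)) refl x (x ^ℚ k) (SineLemmas.r! k) (r (suc k)))
    (cong ((x ^ℚ suc k) *_) (sym (SineLemmas.r!-suc k)))

  sign : ℕ → ℚ
  sign k = (- 1ℚ) ^ℚ k

  module _ (x : ℚ) where

    zero-* : ∀ a b → (a * 0ℚ) * b ≡ 0ℚ
    zero-* = solve 2 (λ a b → (a :* con 0ℚ) :* b := con 0ℚ) refl

    -- The index k counts sign changes: iⁿ is (-1)ᵏ for n = 2k and (-1)ᵏ i for n = 2k + 1.
    Even Odd : ℕ → ℕ → Set
    Even k n = c x n ≡ sign k * pow x n × s x n ≡ 0ℚ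
    Odd  k n = c x n ≡ 0ℚ × s x n ≡ sign k * pow x n

    Even⇒Odd : ∀ k n → Even k n → Odd k (suc n)
    Even⇒Odd k n (c≡ , s≡) =
      trans (cong (λ t → (- x * t) * r (suc n)) s≡) (zero-* (- x) (r (suc n))) ,
      trans (cong (λ t → (x * t) * r (suc n)) c≡)
        (trans (solve 4 (λ x σ p i → (x :* (σ :* p)) :* i := σ :* ((x :* p) :* i)) refl x (sign k) (pow x n) (r (suc n)))
          (cong (sign k *_) (pow-suc x n)))

    Odd⇒Even : ∀ k n → Odd k n → Even (suc k) (suc n)
    Odd⇒Even k n (c≡ , s≡) =
      trans (cong (λ t → (- x * t) * r (suc n)) s≡)
        (trans (solve 4 (λ x σ p i → (:- x :* (σ :* p)) :* i := (:- con 1ℚ :* σ) :* ((x :* p) :* i)) refl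
                 x (sign k) (pow x n) (r (suc n)))
          (cong (sign (suc k) *_) (pow-suc x n))) ,
      trans (cong (λ t → (x * t) * r (suc n)) c≡) (zero-* x (r (suc n)))

    even : ∀ k → Even k (2 ℕ.* k)
    even zero    = refl , refl
    even (suc k) = subst (Even (suc k)) (sym (ℕ.*-suc 2 k))
      (Odd⇒Even k (suc (2 ℕ.* k)) (Even⇒Odd k (2 ℕ.* k) (even k)))

    -- The even coefficients of `s x` vanish, so n odd terms account for the first 2n coefficients.
    -- In this form sine and cosine can be cut off at the same index, as convolution requires.
    sinTaylor-∑ : ∀ n → sinTaylor n x ≡ ∑ (s x) (2 ℕ.* n)
    sinTaylor-∑ zero    = refl
    sinTaylor-∑ (suc n) = trans
      (cong₂ _+_
        (trans (sinTaylor-∑ n) (trans (sym (ℚ.+-identityʳ (∑ (s x) m))) (cong (∑ (s x) m +_) (sym (proj₂ (even n))))))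
        (sym (proj₂ (Even⇒Odd n m (even n)))))
      (cong (∑ (s x)) (sym (ℕ.*-suc 2 n)))
      where
      m : ℕ
      m = 2 ℕ.* n

  -- Products of partial sums

  ∑-shift : ∀ f n → ∑ f (suc n) ≡ f 0 + ∑ (f ∘ suc) n
  ∑-shift f zero    = ℚ.+-comm 0ℚ (f 0)
  ∑-shift f (suc n) = trans (cong (_+ f (suc n)) (∑-shift f n)) (ℚ.+-assoc (f 0) (∑ (f ∘ suc) n) (f (suc n)))

  ∑-cong : ∀ {f g} n → (∀ i → f i ≡ g i) → ∑ f n ≡ ∑ g n
  ∑-cong zero    f≡g = refl
  ∑-cong (suc n) f≡g = cong₂ _+_ (∑-cong n f≡g) (f≡g n)

  ∑-+ : ∀ f g n → ∑ (λ i → f i + g i) n ≡ ∑ f n + ∑ g n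
  ∑-+ f g zero    = refl
  ∑-+ f g (suc n) = trans (cong (_+ (f n + g n)) (∑-+ f g n))
    (solve 4 (λ a b u v → (a :+ b) :+ (u :+ v) := (a :+ u) :+ (b :+ v)) refl (∑ f n) (∑ g n) (f n) (g n))

  ∑-neg : ∀ f n → ∑ (λ i → - f i) n ≡ - ∑ f n
  ∑-neg f zero    = refl
  ∑-neg f (suc n) = trans (cong (_+ - f n) (∑-neg f n)) (sym (ℚ.neg-distrib-+ (∑ f n) (f n)))

  -- The triangle {i + j ≤ n} is its row i = 0 together with a triangle one step smaller.
  ∑-conv : ∀ f g n → ∑ (conv f g) (suc n) ≡ f 0 * ∑ g (suc n) + ∑ (conv (f ∘ suc) g) n
  ∑-conv f g zero    = solve 2 (λ a b → con 0ℚ :+ a :* b := a :* (con 0ℚ :+ b) :+ con 0ℚ) refl (f 0) (g 0)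
  ∑-conv f g (suc n) = trans (cong (_+ conv f g (suc n)) (∑-conv f g n))
    (solve 5 (λ a t e u v → (a :* t :+ u) :+ (a :* e :+ v) := a :* (t :+ e) :+ (u :+ v)) refl
      (f 0) (∑ g (suc n)) (g (suc n)) (∑ (conv (f ∘ suc) g) n) (conv (f ∘ suc) g n))

  infix 4 _≪_
  _≪_ : (ℕ → ℚ) → (ℕ → ℚ) → Set
  f ≪ F = ∀ i → ∣ f i ∣ ≤ F i

  ≪⇒0≤ : ∀ {f F} → f ≪ F → ∀ i → 0ℚ ≤ F i
  ≪⇒0≤ {f} h i = ℚ.≤-trans (ℚ.0≤∣p∣ (f i)) (h i)

  0≤∑ : ∀ {F} → (∀ i → 0ℚ ≤ F i) → ∀ n → 0ℚ ≤ ∑ F n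
  0≤∑ h zero    = ℚ.≤-refl
  0≤∑ h (suc n) = 0≤+ (0≤∑ h n) (h n)

  ∑-mono : ∀ {F} → (∀ i → 0ℚ ≤ F i) → ∀ n i → ∑ F n ≤ ∑ F (i ℕ.+ n)
  ∑-mono h n zero    = ℚ.≤-refl
  ∑-mono h n (suc i) = ℚ.≤-trans (∑-mono h n i) (≤+ (h (i ℕ.+ n)))

  ∑-abs : ∀ {f F} → f ≪ F → ∀ n → ∣ ∑ f n ∣ ≤ ∑ F n
  ∑-abs h zero = ℚ.≤-refl
  ∑-abs {f} h (suc n) = ℚ.≤-trans (ℚ.∣p+q∣≤∣p∣+∣q∣ (∑ f n) (f n)) (ℚ.+-mono-≤ (∑-abs h n) (h n))

  ∑-tail : ∀ {f F} → f ≪ F → ∀ n i → ∣ ∑ f (i ℕ.+ n) - ∑ f n ∣ ≤ ∑ F (i ℕ.+ n) - ∑ F n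
  ∑-tail {f} {F} h n zero = ℚ.≤-reflexive (trans (cong ∣_∣ (ℚ.+-inverseʳ (∑ f n))) (sym (ℚ.+-inverseʳ (∑ F n))))
  ∑-tail {f} {F} h n (suc i) = begin
    ∣ (∑ f k + f k) - ∑ f n ∣       ≡⟨ cong ∣_∣ (id-diffₗ (∑ f k) (f k) (∑ f n)) ⟩
    ∣ (∑ f k - ∑ f n) + f k ∣       ≤⟨ ℚ.∣p+q∣≤∣p∣+∣q∣ (∑ f k - ∑ f n) (f k) ⟩
    ∣ ∑ f k - ∑ f n ∣ + ∣ f k ∣     ≤⟨ ℚ.+-mono-≤ (∑-tail h n i) (h k) ⟩
    (∑ F k - ∑ F n) + F k           ≡⟨ id-diffₗ (∑ F k) (F k) (∑ F n) ⟨
    (∑ F k + F k) - ∑ F n           ∎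
    where
    k : ℕ
    k = i ℕ.+ n

  -- The square {i < m, j < N} exceeds the triangle {i + j < m} by a strip in each row i.
  box-suc : ∀ f g m N → ∑ f (suc m) * ∑ g N - ∑ (conv f g) (suc m) ≡
    f 0 * (∑ g N - ∑ g (suc m)) + (∑ (f ∘ suc) m * ∑ g N - ∑ (conv (f ∘ suc) g) m)
  box-suc f g m N = trans
    (cong₂ (λ u v → u * ∑ g N - v) (∑-shift f m) (∑-conv f g m))
    (solve 5 (λ a b e u v → (a :+ u) :* b :- (a :* e :+ v) := a :* (b :- e) :+ (u :* b :- v)) refl
      (f 0) (∑ g N) (∑ g (suc m)) (∑ (f ∘ suc) m) (∑ (conv (f ∘ suc) g) m))

  -- Rectangle minus triangle is a sum of terms f(i) g(j), each dominated by F(i) G(j). Removing a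
  -- row lowers m but leaves the number N of columns, so the induction runs over rectangles; N ≥ m
  -- makes every strip a tail of g.
  box-bound : ∀ {f g F G} → f ≪ F → g ≪ G → ∀ m i → let N = i ℕ.+ m in
    ∣ ∑ f m * ∑ g N - ∑ (conv f g) m ∣ ≤ ∑ F m * ∑ G N - ∑ (conv F G) m
  box-bound {f} {g} {F} {G} hf hg zero i = ℚ.≤-reflexive
    (trans (cong ∣_∣ (id-0 (∑ g N))) (sym (id-0 (∑ G N))))
    where
    N : ℕ
    N = i ℕ.+ 0
    id-0 : ∀ a → 0ℚ * a - 0ℚ ≡ 0ℚ
    id-0 = solve 1 (λ a → con 0ℚ :* a :- con 0ℚ := con 0ℚ) refl
  box-bound {f} {g} {F} {G} hf hg (suc m) i = begin
    ∣ ∑ f (suc m) * ∑ g N - ∑ (conv f g) (suc m) ∣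
      ≡⟨ cong ∣_∣ (box-suc f g m N) ⟩
    ∣ f 0 * (∑ g N - ∑ g (suc m)) + (∑ (f ∘ suc) m * ∑ g N - ∑ (conv (f ∘ suc) g) m) ∣
      ≤⟨ ℚ.∣p+q∣≤∣p∣+∣q∣ (f 0 * (∑ g N - ∑ g (suc m))) (∑ (f ∘ suc) m * ∑ g N - ∑ (conv (f ∘ suc) g) m) ⟩
    ∣ f 0 * (∑ g N - ∑ g (suc m)) ∣ + ∣ ∑ (f ∘ suc) m * ∑ g N - ∑ (conv (f ∘ suc) g) m ∣
      ≡⟨ cong (_+ ∣ ∑ (f ∘ suc) m * ∑ g N - ∑ (conv (f ∘ suc) g) m ∣) (ℚ.∣p*q∣≡∣p∣*∣q∣ (f 0) (∑ g N - ∑ g (suc m))) ⟩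
    ∣ f 0 ∣ * ∣ ∑ g N - ∑ g (suc m) ∣ + ∣ ∑ (f ∘ suc) m * ∑ g N - ∑ (conv (f ∘ suc) g) m ∣
      ≤⟨ ℚ.+-mono-≤
           (*-mono (ℚ.0≤∣p∣ (f 0)) (ℚ.≤-trans (ℚ.0≤∣p∣ _) (∑-tail hg (suc m) i)) (hf 0) (∑-tail hg (suc m) i))
           (subst (λ N → ∣ ∑ (f ∘ suc) m * ∑ g N - ∑ (conv (f ∘ suc) g) m ∣ ≤ ∑ (F ∘ suc) m * ∑ G N - ∑ (conv (F ∘ suc) G) m)
             (sym (ℕ.+-suc i m)) (box-bound (hf ∘ suc) hg m (suc i))) ⟩
    F 0 * (∑ G N - ∑ G (suc m)) + (∑ (F ∘ suc) m * ∑ G N - ∑ (conv (F ∘ suc) G) m)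
      ≡⟨ box-suc F G m N ⟨
    ∑ F (suc m) * ∑ G N - ∑ (conv F G) (suc m) ∎
    where
    N : ℕ
    N = i ℕ.+ suc m

  -- The rectangle {i < m, j < n} lies in the triangle {i + j < m + n}, and all terms are
  -- nonnegative.
  box≤∑-conv : ∀ {F G} → (∀ i → 0ℚ ≤ F i) → (∀ i → 0ℚ ≤ G i) → ∀ m n → ∑ F m * ∑ G n ≤ ∑ (conv F G) (m ℕ.+ n)
  box≤∑-conv {F} {G} hF hG zero n = ℚ.≤-trans (ℚ.≤-reflexive (ℚ.*-zeroˡ (∑ G n))) (0≤∑ (0≤conv hF) n)
    where
    0≤conv : ∀ {F} → (∀ i → 0ℚ ≤ F i) → ∀ k → 0ℚ ≤ conv F G k
    0≤conv hF zero    = 0≤* (hF 0) (hG 0)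
    0≤conv hF (suc k) = 0≤+ (0≤* (hF 0) (hG (suc k))) (0≤conv (hF ∘ suc) k)
  box≤∑-conv {F} {G} hF hG (suc m) n = begin
    ∑ F (suc m) * ∑ G n                        ≡⟨ cong (_* ∑ G n) (∑-shift F m) ⟩
    (F 0 + ∑ (F ∘ suc) m) * ∑ G n              ≡⟨ ℚ.*-distribʳ-+ (∑ G n) (F 0) (∑ (F ∘ suc) m) ⟩
    F 0 * ∑ G n + ∑ (F ∘ suc) m * ∑ G n        ≤⟨ ℚ.+-mono-≤ (*-monoˡ (hF 0) (∑-mono hG n (suc m))) (box≤∑-conv (hF ∘ suc) hG m n) ⟩
    F 0 * ∑ G (suc (m ℕ.+ n)) + ∑ (conv (F ∘ suc) G) (m ℕ.+ n)
                                               ≡⟨ ∑-conv F G (m ℕ.+ n) ⟨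
    ∑ (conv F G) (suc m ℕ.+ n)                 ∎

  -- The square of side n lies between the triangles of sides n and 2n, so the error becomes a tail
  -- of the single series `conv F G`.
  product-bound : ∀ {f g F G} → f ≪ F → g ≪ G → ∀ n →
    ∣ ∑ f n * ∑ g n - ∑ (conv f g) n ∣ ≤ ∑ (conv F G) (n ℕ.+ n) - ∑ (conv F G) n
  product-bound {f} {g} {F} {G} hf hg n = ℚ.≤-trans (box-bound hf hg n 0)
    (ℚ.+-monoˡ-≤ (- ∑ (conv F G) n) (box≤∑-conv (≪⇒0≤ hf) (≪⇒0≤ hg) n n))

  -- Remainders of the exponential series

  d≥0 : ∀ {B} → 0ℚ ≤ B → ∀ k → 0ℚ ≤ d B k
  d≥0 0≤B zero    = 0≤ι 1
  d≥0 0≤B (suc k) = 0≤* (0≤* 0≤B (d≥0 0≤B k)) (ℚ.<⇒≤ (r>0 (suc k)))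

  step-≪ : ∀ {x M a b} k → ∣ x ∣ ≤ M → ∣ a ∣ ≤ b → ∣ (x * a) * r (suc k) ∣ ≤ (M * b) * r (suc k)
  step-≪ {x} {M} {a} {b} k hx ha = begin
    ∣ (x * a) * r (suc k) ∣         ≡⟨ ℚ.∣p*q∣≡∣p∣*∣q∣ (x * a) (r (suc k)) ⟩
    ∣ x * a ∣ * ∣ r (suc k) ∣       ≡⟨ cong₂ _*_ (ℚ.∣p*q∣≡∣p∣*∣q∣ x a) (ℚ.0≤p⇒∣p∣≡p (ℚ.<⇒≤ (r>0 (suc k)))) ⟩
    (∣ x ∣ * ∣ a ∣) * r (suc k)     ≤⟨ *-monoʳ (ℚ.<⇒≤ (r>0 (suc k)))
                                        (*-mono (ℚ.0≤∣p∣ x) (ℚ.≤-trans (ℚ.0≤∣p∣ a) ha) hx ha) ⟩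
    (M * b) * r (suc k)             ∎

  c-≪ : ∀ {x M} → ∣ x ∣ ≤ M → c x ≪ d M
  s-≪ : ∀ {x M} → ∣ x ∣ ≤ M → s x ≪ d M
  c-≪ hx zero    = ℚ.≤-refl
  c-≪ {x} hx (suc k) = step-≪ { - x} k (subst (_≤ _) (sym (ℚ.∣-p∣≡∣p∣ x)) hx) (s-≪ hx k)
  s-≪ hx zero    = 0≤ι 1
  s-≪ hx (suc k) = step-≪ k hx (c-≪ hx k)

  d-half : ∀ {B} k → 0ℚ ≤ B → B + B ≤ ι k → d B (suc k) ≤ ½ * d B k
  d-half {B} k 0≤B h = begin
    (B * d B k) * r (suc k)   ≡⟨ solve 3 (λ b e i → (b :* e) :* i := (b :* i) :* e) refl B (d B k) (r (suc k)) ⟩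
    (B * r (suc k)) * d B k   ≤⟨ *-monoʳ (d≥0 0≤B k) (*r≤ B ½ (suc k) (begin
      B                         ≡⟨ id-twice B ⟨
      (B + B) * ½               ≤⟨ *-monoʳ (ℚ.<⇒≤ (ℚ.positive⁻¹ ½)) (ℚ.≤-trans h (ℚ.<⇒≤ (ι< k))) ⟩
      ι (suc k) * ½             ∎)) ⟩
    ½ * d B k                 ∎

  module _ B K (0≤B : 0ℚ ≤ B) (B≤K : B + B ≤ ι K) where

    d-half-+ : ∀ i → d B (suc (i ℕ.+ K)) ≤ ½ * d B (i ℕ.+ K)
    d-half-+ i = d-half (i ℕ.+ K) 0≤B (ℚ.≤-trans B≤K (ι-mono (ℕ.m≤n+m K i)))

    -- The decay is geometric, but the weaker 1/(i + 1) is the form that `archimedes` can make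
    -- small; the induction uses ½ · 1/(i + 1) ≤ 1/(i + 2).
    d-decay : ∀ i → d B (i ℕ.+ K) ≤ d B K * r (suc i)
    d-decay zero    = ℚ.≤-reflexive (sym (ℚ.*-identityʳ (d B K)))
    d-decay (suc i) = begin
      d B (suc (i ℕ.+ K))             ≤⟨ d-half-+ i ⟩
      ½ * d B (i ℕ.+ K)               ≤⟨ *-monoˡ (ℚ.<⇒≤ (ℚ.positive⁻¹ ½)) (d-decay i) ⟩
      ½ * (d B K * r (suc i))         ≡⟨ id-assoc ½ (d B K) (r (suc i)) ⟩
      d B K * (½ * r (suc i))         ≤⟨ *-monoˡ (d≥0 0≤B K) (½r≤r i) ⟩
      d B K * r (suc (suc i))         ∎

    -- Since the terms at least halve, ∑_{k<n} Bᵏ/k! plus twice the next term decreases in n.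
    W : ℕ → ℚ
    W n = ∑ (d B) n + (d B n + d B n)

    W-decreasing : ∀ n i → K ℕ.≤ n → W (i ℕ.+ n) ≤ W n
    W-decreasing n zero    K≤n = ℚ.≤-refl
    W-decreasing n (suc i) K≤n = begin
      (∑ (d B) k + d B k) + (d B (suc k) + d B (suc k))   ≤⟨ ℚ.+-monoʳ-≤ (∑ (d B) k + d B k) (ℚ.+-mono-≤ half half) ⟩
      (∑ (d B) k + d B k) + (½ * d B k + ½ * d B k)       ≡⟨ cong (∑ (d B) k + d B k +_) (½+½ (d B k)) ⟩
      (∑ (d B) k + d B k) + d B k                         ≡⟨ ℚ.+-assoc (∑ (d B) k) (d B k) (d B k) ⟩
      W k                                                 ≤⟨ W-decreasing n i K≤n ⟩
      W n                                                 ∎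
      where
      k : ℕ
      k = i ℕ.+ n
      half : d B (suc k) ≤ ½ * d B k
      half = d-half k 0≤B (ℚ.≤-trans B≤K (ι-mono (ℕ.≤-trans K≤n (ℕ.m≤n+m n i))))

    ∑≤W : ∀ n i → K ℕ.≤ n → ∑ (d B) (i ℕ.+ n) ≤ W n
    ∑≤W n i K≤n = ℚ.≤-trans (≤+ (0≤+ (d≥0 0≤B (i ℕ.+ n)) (d≥0 0≤B (i ℕ.+ n)))) (W-decreasing n i K≤n)

    ∑-remainder : ∀ n i → K ℕ.≤ n → ∑ (d B) (i ℕ.+ n) - ∑ (d B) n ≤ d B n + d B n
    ∑-remainder n i K≤n = ℚ.≤-trans (ℚ.+-monoˡ-≤ (- ∑ (d B) n) (∑≤W n i K≤n))
      (ℚ.≤-reflexive (solve 2 (λ a b → (a :+ b) :- a := b) refl (∑ (d B) n) (d B n + d B n)))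

  -- N does not depend on the length i of the segment: in `∑-product` the segment runs from m to 2m
  -- and grows with m.
  remainder→0 : ∀ {B} → 0ℚ ≤ B → ∀ {ε} → 0ℚ ℚ.< ε →
    ∃[ N ] (∀ n i → N ℕ.≤ n → ∑ (d B) (i ℕ.+ n) - ∑ (d B) n ℚ.< ε)
  remainder→0 {B} 0≤B {ε} 0<ε =
    let K , B≤K = bound (B + B)
        I , small = archimedes (d B K + d B K) 0<ε
    in I ℕ.+ K , λ n i I+K≤n →
    let j = n ℕ.∸ K
        K≤n = ℕ.≤-trans (ℕ.m≤n+m K I) I+K≤n
        n≡ = ℕ.m∸n+n≡m K≤n
        decay = subst (λ m → d B m ≤ d B K * r (suc j)) n≡ (d-decay B K 0≤B B≤K j)
    in begin-strict
    ∑ (d B) (i ℕ.+ n) - ∑ (d B) n               ≤⟨ ∑-remainder B K 0≤B B≤K n i K≤n ⟩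
    d B n + d B n                               ≤⟨ ℚ.+-mono-≤ decay decay ⟩
    d B K * r (suc j) + d B K * r (suc j)       ≡⟨ id-dist (d B K) (d B K) (r (suc j)) ⟩
    (d B K + d B K) * r (suc j)                 <⟨ small j (ℕ.m+n≤o⇒m≤o∸n I I+K≤n) ⟩
    ε                                           ∎

  ∑-bounded : ∀ {B} → 0ℚ ≤ B → ∃[ N ] Σ ℚ λ C → ∀ n → N ℕ.≤ n → ∑ (d B) n ≤ C
  ∑-bounded {B} 0≤B =
    let K , B≤K = bound (B + B)
    in K , W B K 0≤B B≤K K , λ n K≤n →
      subst (λ m → ∑ (d B) m ≤ W B K 0≤B B≤K K) (ℕ.m∸n+n≡m K≤n) (∑≤W B K 0≤B B≤K K (n ℕ.∸ K) ℕ.≤-refl)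

-- Rational sequences

module Sequences where

  open RationalLemmas
  open ≡ using (refl; sym; trans; cong; cong₂; subst)
  open ℚ.≤-Reasoning

  infix 4 _~_
  record _~_ (x y : ℕ → ℚ) : Set where
    constructor mk~
    field
      close : ∀ {ε} → 0ℚ ℚ.< ε → ∃[ N ] (∀ n → N ℕ.≤ n → ∣ x n ℚ.- y n ∣ ℚ.< ε)
  open _~_ public

  -- The bound is eventual because the estimates for partial sums start only at some N, and
  -- relations modulo null sequences ignore initial terms.
  Bounded : (ℕ → ℚ) → Set
  Bounded x = Σ ℚ λ B → 0ℚ ℚ.≤ B × ∃[ N ] (∀ n → N ℕ.≤ n → ∣ x n ∣ ℚ.≤ B)

  ~-eventually : ∀ {x y} → ∃[ N ] (∀ n → N ℕ.≤ n → x n ≡ y n) → x ~ y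
  ~-eventually {x} {y} (N , x≡y) = mk~ λ {ε} 0<ε → N , λ n N≤n →
    subst (ℚ._< ε) (sym (cong ∣_∣ (trans (cong (ℚ._- y n) (x≡y n N≤n)) (ℚ.+-inverseʳ (y n))))) 0<ε

  ~-pointwise : ∀ {x y} → (∀ n → x n ≡ y n) → x ~ y
  ~-pointwise x≡y = ~-eventually (0 , λ n _ → x≡y n)

  ~-sym : ∀ {x y} → x ~ y → y ~ x
  ~-sym {x} {y} h = mk~ λ 0<ε → let N , p = close h 0<ε in N , λ n N≤n → subst (ℚ._< _) (∣-∣-sym (x n) (y n)) (p n N≤n)

  ~-trans : ∀ {x y z} → x ~ y → y ~ z → x ~ z
  ~-trans {x} {y} {z} h k = mk~ λ {ε} 0<ε → let M , hc = close h (½> 0<ε) ; N , kc = close k (½> 0<ε) in M ℕ.⊔ N , λ n p → begin-strict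
    ∣ x n ℚ.- z n ∣                         ≤⟨ triangle (x n) (y n) (z n) ⟩
    ∣ x n ℚ.- y n ∣ ℚ.+ ∣ y n ℚ.- z n ∣     <⟨ ℚ.+-mono-< (hc n (ℕ.m⊔n≤o⇒m≤o M N p)) (kc n (ℕ.m⊔n≤o⇒n≤o M N p)) ⟩
    ½ ℚ.* ε ℚ.+ ½ ℚ.* ε                     ≡⟨ ½+½ ε ⟩
    ε                                       ∎

  ~-+ : ∀ {x x′ y y′} → x ~ x′ → y ~ y′ → (λ n → x n ℚ.+ y n) ~ (λ n → x′ n ℚ.+ y′ n)
  ~-+ {x} {x′} {y} {y′} h k = mk~ λ {ε} 0<ε → let M , hc = close h (½> 0<ε) ; N , kc = close k (½> 0<ε) in M ℕ.⊔ N , λ n p → begin-strict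
    ∣ (x n ℚ.+ y n) ℚ.- (x′ n ℚ.+ y′ n) ∣     ≡⟨ cong ∣_∣ (id-plus (x n) (y n) (x′ n) (y′ n)) ⟩
    ∣ (x n ℚ.- x′ n) ℚ.+ (y n ℚ.- y′ n) ∣     ≤⟨ ℚ.∣p+q∣≤∣p∣+∣q∣ (x n ℚ.- x′ n) (y n ℚ.- y′ n) ⟩
    ∣ x n ℚ.- x′ n ∣ ℚ.+ ∣ y n ℚ.- y′ n ∣     <⟨ ℚ.+-mono-< (hc n (ℕ.m⊔n≤o⇒m≤o M N p)) (kc n (ℕ.m⊔n≤o⇒n≤o M N p)) ⟩
    ½ ℚ.* ε ℚ.+ ½ ℚ.* ε                       ≡⟨ ½+½ ε ⟩
    ε                                         ∎

  ~-neg : ∀ {x y} → x ~ y → (λ n → ℚ.- x n) ~ (λ n → ℚ.- y n)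
  ~-neg {x} {y} h = mk~ λ 0<ε → let N , p = close h 0<ε in N , λ n N≤n → subst (ℚ._< _)
    (trans (sym (ℚ.∣-p∣≡∣p∣ (x n ℚ.- y n))) (cong ∣_∣ (id-minus (x n) (y n)))) (p n N≤n)

  ~-* : ∀ {x x′ y y′} → Bounded x → Bounded y′ → x ~ x′ → y ~ y′ → (λ n → x n ℚ.* y n) ~ (λ n → x′ n ℚ.* y′ n)
  ~-* {x} {x′} {y} {y′} (A , 0≤A , I , hA) (B , 0≤B , J , hB) h k = mk~ λ {ε} 0<ε →
    let δ , 0<δ , Aδ = shrink A (½> 0<ε)
        γ , 0<γ , Bγ = shrink B (½> 0<ε)
        M , hc = close h 0<γ
        N , kc = close k 0<δ
    in (I ℕ.⊔ J) ℕ.⊔ (M ℕ.⊔ N) , λ n p →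
    let IJ≤n = ℕ.m⊔n≤o⇒m≤o (I ℕ.⊔ J) (M ℕ.⊔ N) p
        MN≤n = ℕ.m⊔n≤o⇒n≤o (I ℕ.⊔ J) (M ℕ.⊔ N) p
        x≤A = hA n (ℕ.m⊔n≤o⇒m≤o I J IJ≤n)
        y≤B = hB n (ℕ.m⊔n≤o⇒n≤o I J IJ≤n)
    in begin-strict
    ∣ x n ℚ.* y n ℚ.- x′ n ℚ.* y′ n ∣
      ≡⟨ cong ∣_∣ (id-times (x n) (y n) (x′ n) (y′ n)) ⟩
    ∣ x n ℚ.* (y n ℚ.- y′ n) ℚ.+ y′ n ℚ.* (x n ℚ.- x′ n) ∣
      ≤⟨ ℚ.∣p+q∣≤∣p∣+∣q∣ (x n ℚ.* (y n ℚ.- y′ n)) (y′ n ℚ.* (x n ℚ.- x′ n)) ⟩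
    ∣ x n ℚ.* (y n ℚ.- y′ n) ∣ ℚ.+ ∣ y′ n ℚ.* (x n ℚ.- x′ n) ∣
      ≡⟨ cong₂ ℚ._+_ (ℚ.∣p*q∣≡∣p∣*∣q∣ (x n) (y n ℚ.- y′ n)) (ℚ.∣p*q∣≡∣p∣*∣q∣ (y′ n) (x n ℚ.- x′ n)) ⟩
    ∣ x n ∣ ℚ.* ∣ y n ℚ.- y′ n ∣ ℚ.+ ∣ y′ n ∣ ℚ.* ∣ x n ℚ.- x′ n ∣
      ≤⟨ ℚ.+-mono-≤
           (*-mono (ℚ.0≤∣p∣ (x n)) (ℚ.<⇒≤ 0<δ) x≤A (ℚ.<⇒≤ (kc n (ℕ.m⊔n≤o⇒n≤o M N MN≤n))))
           (*-mono (ℚ.0≤∣p∣ (y′ n)) (ℚ.<⇒≤ 0<γ) y≤B (ℚ.<⇒≤ (hc n (ℕ.m⊔n≤o⇒m≤o M N MN≤n)))) ⟩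
    A ℚ.* δ ℚ.+ B ℚ.* γ
      <⟨ ℚ.+-mono-< Aδ Bγ ⟩
    ½ ℚ.* ε ℚ.+ ½ ℚ.* ε
      ≡⟨ ½+½ ε ⟩
    ε ∎

  -- Products of null sequences and bounded sequences are null, so convergence need not be required.
  record BoundedSeq : Set where
    constructor mkSeq
    field
      seq     : ℕ → ℚ
      bounded : Bounded seq
  open BoundedSeq public

  infix 4 _≈_
  record _≈_ (x y : BoundedSeq) : Set where
    constructor mk≈
    field
      seq~ : seq x ~ seq y
  open _≈_ public

  constant : ℚ → BoundedSeq
  constant q = mkSeq (λ _ → q) (∣ q ∣ , ℚ.0≤∣p∣ q , 0 , λ _ _ → ℚ.≤-refl)

  infix  8 -_
  infixl 7 _*_
  infixl 6 _+_

  _+_ _*_ : BoundedSeq → BoundedSeq → BoundedSeq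
  -_ : BoundedSeq → BoundedSeq

  abstract

    bounded-+ : ∀ {x y} → Bounded x → Bounded y → Bounded (λ n → x n ℚ.+ y n)
    bounded-+ {x} {y} (A , 0≤A , M , hx) (B , 0≤B , N , hy) = A ℚ.+ B , 0≤+ 0≤A 0≤B , M ℕ.⊔ N , λ n p →
      ℚ.≤-trans (ℚ.∣p+q∣≤∣p∣+∣q∣ (x n) (y n)) (ℚ.+-mono-≤ (hx n (ℕ.m⊔n≤o⇒m≤o M N p)) (hy n (ℕ.m⊔n≤o⇒n≤o M N p)))

    bounded-* : ∀ {x y} → Bounded x → Bounded y → Bounded (λ n → x n ℚ.* y n)
    bounded-* {x} {y} (A , 0≤A , M , hx) (B , 0≤B , N , hy) = A ℚ.* B , 0≤* 0≤A 0≤B , M ℕ.⊔ N , λ n p →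
      ℚ.≤-trans (ℚ.≤-reflexive (ℚ.∣p*q∣≡∣p∣*∣q∣ (x n) (y n)))
        (*-mono (ℚ.0≤∣p∣ (x n)) 0≤B (hx n (ℕ.m⊔n≤o⇒m≤o M N p)) (hy n (ℕ.m⊔n≤o⇒n≤o M N p)))

    bounded-neg : ∀ {x} → Bounded x → Bounded (λ n → ℚ.- x n)
    bounded-neg {x} (A , 0≤A , M , hx) = A , 0≤A , M , λ n p → subst (ℚ._≤ A) (sym (ℚ.∣-p∣≡∣p∣ (x n))) (hx n p)

    bounded-cauchy : ∀ {x} → IsCauchy x → Bounded x
    bounded-cauchy {x} cx =
      let B , 1≤B , h = CauchyLemmas.bounded {x} cx in B , ℚ.≤-trans (0≤ι 1) 1≤B , 0 , λ n _ → h n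

  x + y = mkSeq (λ n → seq x n ℚ.+ seq y n) (bounded-+ {seq x} {seq y} (bounded x) (bounded y))
  x * y = mkSeq (λ n → seq x n ℚ.* seq y n) (bounded-* {seq x} {seq y} (bounded x) (bounded y))
  - x   = mkSeq (λ n → ℚ.- seq x n) (bounded-neg {seq x} (bounded x))

  pointwise : ∀ {x y} → (∀ n → seq x n ≡ seq y n) → x ≈ y
  pointwise x≡y = mk≈ (~-pointwise x≡y)

  commutativeRing : CommutativeRing 0ℓ 0ℓ
  commutativeRing = record
    { Carrier = BoundedSeq
    ; _≈_ = _≈_
    ; _+_ = _+_
    ; _*_ = _*_
    ; -_  = -_
    ; 0#  = constant 0ℚ
    ; 1#  = constant 1ℚ
    ; isCommutativeRing = record
      { isRing = record
        { +-isAbelianGroup = record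
          { isGroup = record
            { isMonoid = record
              { isSemigroup = record
                { isMagma = record
                  { isEquivalence = record
                    { refl  = pointwise (λ _ → refl)
                    ; sym   = λ p → mk≈ (~-sym (seq~ p))
                    ; trans = λ p q → mk≈ (~-trans (seq~ p) (seq~ q))
                    }
                  ; ∙-cong = λ p q → mk≈ (~-+ (seq~ p) (seq~ q))
                  }
                ; assoc = λ x y z → pointwise (λ n → ℚ.+-assoc (seq x n) (seq y n) (seq z n))
                }
              ; identity = (λ x → pointwise (λ n → ℚ.+-identityˡ (seq x n))) ,
                           (λ x → pointwise (λ n → ℚ.+-identityʳ (seq x n)))
              }
            ; inverse = (λ x → pointwise (λ n → ℚ.+-inverseˡ (seq x n))) ,
                        (λ x → pointwise (λ n → ℚ.+-inverseʳ (seq x n)))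
            ; ⁻¹-cong = λ p → mk≈ (~-neg (seq~ p))
            }
          ; comm = λ x y → pointwise (λ n → ℚ.+-comm (seq x n) (seq y n))
          }
        ; *-cong = λ {x} {x′} {y} {y′} p q → mk≈ (~-* (bounded x) (bounded y′) (seq~ p) (seq~ q))
        ; *-assoc = λ x y z → pointwise (λ n → ℚ.*-assoc (seq x n) (seq y n) (seq z n))
        ; *-identity = (λ x → pointwise (λ n → ℚ.*-identityˡ (seq x n))) ,
                       (λ x → pointwise (λ n → ℚ.*-identityʳ (seq x n)))
        ; distrib = (λ x y z → pointwise (λ n → ℚ.*-distribˡ-+ (seq x n) (seq y n) (seq z n))) ,
                    (λ x y z → pointwise (λ n → ℚ.*-distribʳ-+ (seq x n) (seq y n) (seq z n)))
        }
      ; *-comm = λ x y → pointwise (λ n → ℚ.*-comm (seq x n) (seq y n))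
      }
    }

  -- Forgets convergence but keeps the terms, so it commutes termwise with the operations, and `≈`
  -- between two images gives back `≃`.
  ⌊_⌋ : ℝ → BoundedSeq
  ⌊ x ⌋ = mkSeq (ℝ.seq x) (bounded-cauchy {ℝ.seq x} (ℝ.cauchy x))

  -- Apartness keeps the terms away from 0 from N on, where `CauchyLemmas.inv` is a true reciprocal;
  -- earlier terms do not affect `≈`.
  ⌊⌋-inverse : ∀ x (x#0 : x # 0ℝ) → ⌊ x ⌋ * ⌊ inverse x x#0 ⌋ ≈ constant 1ℚ
  ⌊⌋-inverse x (mk# δ 0<δ (N , far)) = mk≈ (~-eventually (N , λ n N≤n → CauchyLemmas.inv-inverse {ℝ.seq x n} λ x≡0 →
    ℚ.<-irrefl refl (ℚ.<-≤-trans 0<δ (subst (λ a → δ ℚ.≤ ∣ a ℚ.- 0ℚ ∣) x≡0 (far n N≤n)))))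

-- Addition formulas for the diagonal Taylor sequences

module Trigonometry where

  open RationalLemmas
  open ≡ using (refl; sym; trans; cong; cong₂; subst)
  open Sequences
  open Series using (∑; conv; d; c; s; _≪_)
  open ℚ.≤-Reasoning

  cosTaylor : ℕ → ℚ → ℚ
  cosTaylor n x = ∑ (c x) (2 ℕ.* n)

  n≤2n : ∀ n → n ℕ.≤ 2 ℕ.* n
  n≤2n n = ℕ.m≤m+n n (n ℕ.+ 0)

  -- The coefficients f(n) vary with n because the argument does; the common majorant `d B` makes
  -- the bound uniform.
  ∑-bounded : ∀ {B} → 0ℚ ℚ.≤ B → (f : ℕ → ℕ → ℚ) → ∃[ N ] (∀ n → N ℕ.≤ n → f n ≪ d B) →
              Bounded (λ n → ∑ (f n) (2 ℕ.* n))
  ∑-bounded 0≤B f (M , f≪d) =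
    let N , C , h = Series.∑-bounded 0≤B
        below = λ n p → ℚ.≤-trans (Series.∑-abs (f≪d n (ℕ.m⊔n≤o⇒m≤o M N p)) (2 ℕ.* n))
          (h (2 ℕ.* n) (ℕ.≤-trans (ℕ.m⊔n≤o⇒n≤o M N p) (n≤2n n)))
    in C , ℚ.≤-trans (ℚ.0≤∣p∣ _) (below (M ℕ.⊔ N) ℕ.≤-refl) , M ℕ.⊔ N , below

  abstract

    bounded-sin : ∀ {x} → Bounded x → Bounded (λ n → sinTaylor n (x n))
    bounded-sin {x} (B , 0≤B , N , h) =
      let C , 0≤C , M , k = ∑-bounded 0≤B (λ n → s (x n)) (N , λ n p → Series.s-≪ (h n p))
      in C , 0≤C , M , λ n p → subst (λ t → ∣ t ∣ ℚ.≤ C) (sym (Series.sinTaylor-∑ (x n) n)) (k n p)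

    bounded-cos : ∀ {x} → Bounded x → Bounded (λ n → cosTaylor n (x n))
    bounded-cos {x} (B , 0≤B , N , h) = ∑-bounded 0≤B (λ n → c (x n)) (N , λ n p → Series.c-≪ (h n p))

  Sin Cos : BoundedSeq → BoundedSeq
  Sin x = mkSeq (λ n → sinTaylor n (seq x n)) (bounded-sin {seq x} (bounded x))
  Cos x = mkSeq (λ n → cosTaylor n (seq x n)) (bounded-cos {seq x} (bounded x))

  ∑-product : ∀ {M N} (f g : ℕ → ℕ → ℚ) → 0ℚ ℚ.≤ M →
    (∀ n → N ℕ.≤ n → f n ≪ d M) → (∀ n → N ℕ.≤ n → g n ≪ d M) →
    (λ n → ∑ (conv (f n) (g n)) (2 ℕ.* n)) ~ (λ n → ∑ (f n) (2 ℕ.* n) ℚ.* ∑ (g n) (2 ℕ.* n))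
  ∑-product {M} {N} f g 0≤M hf hg = mk~ λ {ε} 0<ε →
    let I , small = Series.remainder→0 (0≤+ 0≤M 0≤M) 0<ε
    in N ℕ.⊔ I , λ n p → let m = 2 ℕ.* n in begin-strict
    ∣ ∑ (conv (f n) (g n)) m ℚ.- ∑ (f n) m ℚ.* ∑ (g n) m ∣
      ≡⟨ ∣-∣-sym (∑ (conv (f n) (g n)) m) (∑ (f n) m ℚ.* ∑ (g n) m) ⟩
    ∣ ∑ (f n) m ℚ.* ∑ (g n) m ℚ.- ∑ (conv (f n) (g n)) m ∣
      ≤⟨ Series.product-bound (hf n (ℕ.m⊔n≤o⇒m≤o N I p)) (hg n (ℕ.m⊔n≤o⇒m≤o N I p)) m ⟩
    ∑ (conv (d M) (d M)) (m ℕ.+ m) ℚ.- ∑ (conv (d M) (d M)) m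
      -- The majorant of the product is again an exponential series, now at 2M, so its tails are
      -- known to vanish.
      ≡⟨ cong₂ ℚ._-_ (Series.∑-cong (m ℕ.+ m) (Series.d-+ M M)) (Series.∑-cong m (Series.d-+ M M)) ⟩
    ∑ (d (M ℚ.+ M)) (m ℕ.+ m) ℚ.- ∑ (d (M ℚ.+ M)) m
      <⟨ small m m (ℕ.≤-trans (ℕ.m⊔n≤o⇒n≤o N I p) (n≤2n n)) ⟩
    ε ∎

  module _ (x y : BoundedSeq) where

    private
      A B M : ℚ
      A = proj₁ (bounded x)
      B = proj₁ (bounded y)
      -- One majorant for both arguments: A and B are nonnegative, so their sum exceeds each.
      M = A ℚ.+ B
      0≤A : 0ℚ ℚ.≤ A
      0≤A = proj₁ (proj₂ (bounded x))
      0≤B : 0ℚ ℚ.≤ B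
      0≤B = proj₁ (proj₂ (bounded y))
      I J : ℕ
      I = proj₁ (proj₂ (proj₂ (bounded x)))
      J = proj₁ (proj₂ (proj₂ (bounded y)))
      x≤M : ∀ n → I ℕ.⊔ J ℕ.≤ n → ∣ seq x n ∣ ℚ.≤ M
      x≤M n p = ℚ.≤-trans (proj₂ (proj₂ (proj₂ (bounded x))) n (ℕ.m⊔n≤o⇒m≤o I J p)) (≤+ 0≤B)
      y≤M : ∀ n → I ℕ.⊔ J ℕ.≤ n → ∣ seq y n ∣ ℚ.≤ M
      y≤M n p = ℚ.≤-trans (proj₂ (proj₂ (proj₂ (bounded y))) n (ℕ.m⊔n≤o⇒n≤o I J p))
        (subst (B ℚ.≤_) (ℚ.+-comm B A) (≤+ 0≤A))
      product : (f g : ℚ → ℕ → ℚ) → (∀ {a M} → ∣ a ∣ ℚ.≤ M → f a ≪ d M) → (∀ {a M} → ∣ a ∣ ℚ.≤ M → g a ≪ d M) →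
        (λ n → ∑ (conv (f (seq x n)) (g (seq y n))) (2 ℕ.* n)) ~
        (λ n → ∑ (f (seq x n)) (2 ℕ.* n) ℚ.* ∑ (g (seq y n)) (2 ℕ.* n))
      product f g hf hg = ∑-product (λ n → f (seq x n)) (λ n → g (seq y n)) (0≤+ 0≤A 0≤B)
        (λ n p → hf (x≤M n p)) (λ n p → hg (y≤M n p))

    Sin-+ : Sin (x + y) ≈ Sin x * Cos y + Cos x * Sin y
    Sin-+ = mk≈ (~-trans (~-pointwise expand)
      (~-trans (~-+ (product s c Series.s-≪ Series.c-≪) (product c s Series.c-≪ Series.s-≪))
        (~-pointwise (λ n → cong₂ ℚ._+_
          (cong (ℚ._* cosTaylor n (seq y n)) (sym (Series.sinTaylor-∑ (seq x n) n)))
          (cong (cosTaylor n (seq x n) ℚ.*_) (sym (Series.sinTaylor-∑ (seq y n) n)))))))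
      where
      expand : ∀ n → sinTaylor n (seq x n ℚ.+ seq y n) ≡
        ∑ (conv (s (seq x n)) (c (seq y n))) (2 ℕ.* n) ℚ.+ ∑ (conv (c (seq x n)) (s (seq y n))) (2 ℕ.* n)
      expand n = trans (Series.sinTaylor-∑ (seq x n ℚ.+ seq y n) n)
        (trans (Series.∑-cong (2 ℕ.* n) (λ k → sym (Series.s-+ (seq x n) (seq y n) k)))
          (Series.∑-+ (conv (s (seq x n)) (c (seq y n))) (conv (c (seq x n)) (s (seq y n))) (2 ℕ.* n)))

    Cos-+ : Cos (x + y) ≈ Cos x * Cos y + - (Sin x * Sin y)
    Cos-+ = mk≈ (~-trans (~-pointwise expand)
      (~-trans (~-+ (product c c Series.c-≪ Series.c-≪) (~-neg (product s s Series.s-≪ Series.s-≪)))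
        (~-pointwise (λ n → cong₂ (λ u v → cosTaylor n (seq x n) ℚ.* cosTaylor n (seq y n) ℚ.+ ℚ.- (u ℚ.* v))
          (sym (Series.sinTaylor-∑ (seq x n) n)) (sym (Series.sinTaylor-∑ (seq y n) n))))))
      where
      expand : ∀ n → cosTaylor n (seq x n ℚ.+ seq y n) ≡
        ∑ (conv (c (seq x n)) (c (seq y n))) (2 ℕ.* n) ℚ.+ ℚ.- ∑ (conv (s (seq x n)) (s (seq y n))) (2 ℕ.* n)
      expand n =
        trans (Series.∑-cong (2 ℕ.* n) (λ k → sym (Series.c-+ (seq x n) (seq y n) k)))
          (trans (Series.∑-+ (conv (c (seq x n)) (c (seq y n))) (λ k → ℚ.- conv (s (seq x n)) (s (seq y n)) k) (2 ℕ.* n))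
            (cong (∑ (conv (c (seq x n)) (c (seq y n))) (2 ℕ.* n) ℚ.+_)
              (Series.∑-neg (conv (s (seq x n)) (s (seq y n))) (2 ℕ.* n))))

  Sin-cong : ∀ {x y} → (∀ n → seq x n ≡ seq y n) → Sin x ≈ Sin y
  Sin-cong x≡y = pointwise (λ n → cong (sinTaylor n) (x≡y n))

  Cos-cong : ∀ {x y} → (∀ n → seq x n ≡ seq y n) → Cos x ≈ Cos y
  Cos-cong x≡y = pointwise (λ n → cong (cosTaylor n) (x≡y n))

  sinTaylor-neg : ∀ n x → sinTaylor n (ℚ.- x) ≡ ℚ.- sinTaylor n x
  sinTaylor-neg n x = trans (Series.sinTaylor-∑ (ℚ.- x) n)
    (trans (Series.∑-cong (2 ℕ.* n) (Series.s-neg x))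
      (trans (Series.∑-neg (s x) (2 ℕ.* n)) (cong ℚ.-_ (sym (Series.sinTaylor-∑ x n)))))

  cosTaylor-neg : ∀ n x → cosTaylor n (ℚ.- x) ≡ cosTaylor n x
  cosTaylor-neg n x = Series.∑-cong (2 ℕ.* n) (Series.c-neg x)

  Cos-0 : Cos (constant 0ℚ) ≈ constant 1ℚ
  -- At n = 0 the sum is empty and equals 0, so the value 1 is taken from n = 1 on.
  Cos-0 = mk≈ (~-eventually (1 , λ { (suc n) _ → ∑c0≡1 (n ℕ.+ suc (n ℕ.+ 0)) }))
    where
    c0≡0 : ∀ k → c 0ℚ (suc k) ≡ 0ℚ
    c0≡0 k = trans (cong (ℚ._* r (suc k)) (ℚ.*-zeroˡ (s 0ℚ k))) (ℚ.*-zeroˡ (r (suc k)))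
    ∑c0≡1 : ∀ k → ∑ (c 0ℚ) (suc k) ≡ 1ℚ
    ∑c0≡1 zero    = refl
    ∑c0≡1 (suc k) = trans (cong₂ ℚ._+_ (∑c0≡1 k) (c0≡0 k)) (ℚ.+-identityʳ 1ℚ)

  -- The addition formula for the cosine at x + (-x), with the parity of sine and cosine.
  pythagoras : ∀ x → Sin x * Sin x + Cos x * Cos x ≈ constant 1ℚ
  pythagoras x = mk≈
    (~-trans (~-pointwise sign) (~-trans (~-sym (seq~ (Cos-+ x (- x))))
    (~-trans (~-pointwise (λ n → cong (cosTaylor n) (ℚ.+-inverseʳ (seq x n)))) (seq~ Cos-0))))
    where
    open ℚ.+-*-Solver using (solve; _:+_; _:*_; :-_; _:=_)
    sign : ∀ n → seq (Sin x * Sin x + Cos x * Cos x) n ≡ seq (Cos x * Cos (- x) + - (Sin x * Sin (- x))) n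
    sign n = trans
      (solve 2 (λ a b → a :* a :+ b :* b := b :* b :+ :- (a :* :- a)) refl (seq (Sin x) n) (seq (Cos x) n))
      (sym (cong₂ (λ a b → seq (Cos x) n ℚ.* b ℚ.+ ℚ.- (seq (Sin x) n ℚ.* a))
        (sinTaylor-neg n (seq x n)) (cosTaylor-neg n (seq x n))))

-- Fibonacci arithmetic in ℕ

module ℕIdentities where

  open import Data.Nat.Base using (_+_; _*_)
  open ℕ.+-*-Solver using (solve; _:+_; _:*_; _:=_; con)

  -- Used with t = 5ᵏ⁺¹, v = F₂ₖ₊₂ and w = F₂ₖ₊₁, as is `even-step`. The subtracted term of the
  -- recurrence is moved to the right so as to stay in ℕ.
  odd-step : ∀ t v w → 5 * (t * (w + (v + w))) ≡ 5 * t * (v + w) + 5 * (t * w)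
  odd-step = solve 3 (λ t v w →
    con 5 :* (t :* (w :+ (v :+ w))) := con 5 :* t :* (v :+ w) :+ con 5 :* (t :* w)) ≡.refl

  even-step : ∀ t v w →
    5 * (5 * t * (v + w)) ≡ 5 * t * ((v + w) + (((v + w) + v) + (v + w))) + 5 * (t * (w + (v + w)))
  even-step = solve 3 (λ t v w →
    con 5 :* (con 5 :* t :* (v :+ w)) :=
    con 5 :* t :* ((v :+ w) :+ (((v :+ w) :+ v) :+ (v :+ w))) :+ con 5 :* (t :* (w :+ (v :+ w)))) ≡.refl

  regroup : ∀ t f l → 6 * t * (f * l) ≡ 2 * (3 * t) * f * l
  regroup = solve 3 (λ t f l → con 6 :* t :* (f :* l) := con 2 :* (con 3 :* t) :* f :* l) ≡.refl

-- Algebra of the angle π/5 over a commutative ring with a map from ℚ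

module Pentagon {a ℓ} (R : CommutativeRing a ℓ)
  (morphism : ℚ.+-*-rawRing -Raw-AlmostCommutative⟶ fromCommutativeRing R) where

  open CommutativeRing R hiding (zero)
  open _-Raw-AlmostCommutative⟶_ morphism using (⟦_⟧; +-homo; *-homo; 1-homo)
  open Algebra.Properties.Semiring.Exp semiring using (_^_; ^-congˡ; ^-assocʳ)
  open Algebra.Properties.CommutativeSemiring.Exp commutativeSemiring using (^-distrib-*)
  open RationalLemmas using (ι; ι-+; ι-*)
  open ℕIdentities using (odd-step; even-step)
  open import Relation.Binary.Reasoning.Setoid setoid

  private
    _coeff≟_ : ∀ p q → Maybe (⟦ p ⟧ ≈ ⟦ q ⟧)
    p coeff≟ q with p ℚ.≟ q
    ... | yes ≡.refl = just refl
    ... | no _       = nothing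

  open Algebra.Solver.Ring ℚ.+-*-rawRing (fromCommutativeRing R) morphism _coeff≟_
    using (solve; _:+_; _:*_; _:-_; :-_; _:=_; con; Polynomial)

  private
    # : ∀ {n} → ℕ → Polynomial n
    # = con ∘ ι
    n# : ℕ → Carrier
    n# = ⟦_⟧ ∘ ι

  -- The multiples are reached as 4θ = 2θ + 2θ and 5θ = 2θ + 3θ, so cosines occur only up to 3θ.
  module Sines {s₁ s₂ s₃ s₄ s₅ c₁ c₂ c₃ u : Carrier}
    (s₁²+c₁² : s₁ * s₁ + c₁ * c₁ ≈ n# 1)
    (s₂≈ : s₂ ≈ s₁ * c₁ + c₁ * s₁) (c₂≈ : c₂ ≈ c₁ * c₁ + - (s₁ * s₁))
    (s₃≈ : s₃ ≈ s₂ * c₁ + c₂ * s₁) (c₃≈ : c₃ ≈ c₂ * c₁ + - (s₂ * s₁))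
    (s₄≈ : s₄ ≈ s₂ * c₂ + c₂ * s₂) (s₅≈ : s₅ ≈ s₂ * c₃ + c₂ * s₃)
    (s₅≈0 : s₅ ≈ n# 0) (u-inverse : s₁ * u ≈ n# 1)
    where

    -- Q = sin 5θ / sin θ as a polynomial in A = sin² θ; and B = sin² 2θ.
    A B Q : Carrier
    A = s₁ * s₁
    B = n# 4 * A * (n# 1 - A)
    Q = n# 16 * A * A - n# 20 * A + n# 5

    c₁² : c₁ * c₁ ≈ n# 1 - A
    c₁² = trans (solve 2 (λ a c → c := (a :+ c) :- a) refl A (c₁ * c₁)) (+-congʳ s₁²+c₁²)

    S₂ : s₂ ≈ n# 2 * s₁ * c₁
    S₂ = trans s₂≈ (solve 2 (λ s c → s :* c :+ c :* s := # 2 :* s :* c) refl s₁ c₁)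

    C₂ : c₂ ≈ n# 1 - n# 2 * A
    C₂ = trans c₂≈ (trans (+-congʳ c₁²)
      (solve 1 (λ a → # 1 :- a :+ :- a := # 1 :- # 2 :* a) refl A))

    S₃ : s₃ ≈ s₁ * (n# 3 - n# 4 * A)
    S₃ = begin
      s₃                                                            ≈⟨ s₃≈ ⟩
      s₂ * c₁ + c₂ * s₁                                             ≈⟨ +-cong (*-congʳ S₂) (*-congʳ C₂) ⟩
      n# 2 * s₁ * c₁ * c₁ + (n# 1 - n# 2 * A) * s₁                  ≈⟨ +-congʳ (*-assoc (n# 2 * s₁) c₁ c₁) ⟩
      n# 2 * s₁ * (c₁ * c₁) + (n# 1 - n# 2 * A) * s₁                ≈⟨ +-congʳ (*-congˡ c₁²) ⟩
      n# 2 * s₁ * (n# 1 - A) + (n# 1 - n# 2 * A) * s₁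
        ≈⟨ solve 2 (λ s a → # 2 :* s :* (# 1 :- a) :+ (# 1 :- # 2 :* a) :* s := s :* (# 3 :- # 4 :* a)) refl s₁ A ⟩
      s₁ * (n# 3 - n# 4 * A)                                        ∎

    C₃ : c₃ ≈ c₁ * (n# 1 - n# 4 * A)
    C₃ = begin
      c₃                                                            ≈⟨ c₃≈ ⟩
      c₂ * c₁ + - (s₂ * s₁)                                         ≈⟨ +-cong (*-congʳ C₂) (-‿cong (*-congʳ S₂)) ⟩
      (n# 1 - n# 2 * A) * c₁ + - (n# 2 * s₁ * c₁ * s₁)
        ≈⟨ solve 2 (λ s c → (# 1 :- # 2 :* (s :* s)) :* c :+ :- (# 2 :* s :* c :* s) := c :* (# 1 :- # 4 :* (s :* s))) refl s₁ c₁ ⟩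
      c₁ * (n# 1 - n# 4 * A)                                        ∎

    S₄ : s₄ ≈ n# 4 * s₁ * c₁ * (n# 1 - n# 2 * A)
    S₄ = begin
      s₄                                                            ≈⟨ s₄≈ ⟩
      s₂ * c₂ + c₂ * s₂
        ≈⟨ solve 2 (λ s c → s :* c :+ c :* s := # 2 :* s :* c) refl s₂ c₂ ⟩
      n# 2 * s₂ * c₂                                                ≈⟨ *-cong (*-congˡ S₂) C₂ ⟩
      n# 2 * (n# 2 * s₁ * c₁) * (n# 1 - n# 2 * A)
        ≈⟨ solve 3 (λ s c d → # 2 :* (# 2 :* s :* c) :* d := # 4 :* s :* c :* d) refl s₁ c₁ (n# 1 - n# 2 * A) ⟩
      n# 4 * s₁ * c₁ * (n# 1 - n# 2 * A)                            ∎

    s₅≈s₁Q : s₅ ≈ s₁ * Q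
    s₅≈s₁Q = begin
      s₅                                                            ≈⟨ s₅≈ ⟩
      s₂ * c₃ + c₂ * s₃                                             ≈⟨ +-cong (*-cong S₂ C₃) (*-cong C₂ S₃) ⟩
      n# 2 * s₁ * c₁ * (c₁ * (n# 1 - n# 4 * A)) + (n# 1 - n# 2 * A) * (s₁ * (n# 3 - n# 4 * A))
        ≈⟨ solve 3 (λ s c a → # 2 :* s :* c :* (c :* (# 1 :- # 4 :* a)) :+ (# 1 :- # 2 :* a) :* (s :* (# 3 :- # 4 :* a)) :=
             s :* (# 2 :* (# 1 :- # 4 :* a) :* (c :* c) :+ (# 1 :- # 2 :* a) :* (# 3 :- # 4 :* a))) refl s₁ c₁ A ⟩
      s₁ * (n# 2 * (n# 1 - n# 4 * A) * (c₁ * c₁) + (n# 1 - n# 2 * A) * (n# 3 - n# 4 * A))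
        ≈⟨ *-congˡ (+-congʳ (*-congˡ c₁²)) ⟩
      s₁ * (n# 2 * (n# 1 - n# 4 * A) * (n# 1 - A) + (n# 1 - n# 2 * A) * (n# 3 - n# 4 * A))
        ≈⟨ *-congˡ (solve 1 (λ a → # 2 :* (# 1 :- # 4 :* a) :* (# 1 :- a) :+ (# 1 :- # 2 :* a) :* (# 3 :- # 4 :* a) :=
             # 16 :* a :* a :- # 20 :* a :+ # 5) refl A) ⟩
      s₁ * Q                                                        ∎

    -- From s₁Q ≈ s₅ ≈ 0. The factor s₁ is removed by its inverse u, as zero divisors may exist.
    Q≈0 : Q ≈ n# 0
    Q≈0 = begin
      Q                  ≈⟨ solve 1 (λ q → q := # 1 :* q) refl Q ⟩
      n# 1 * Q           ≈⟨ *-congʳ u-inverse ⟨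
      s₁ * u * Q         ≈⟨ solve 3 (λ s u q → s :* u :* q := u :* (s :* q)) refl s₁ u Q ⟩
      u * (s₁ * Q)       ≈⟨ *-congˡ (trans (sym s₅≈s₁Q) s₅≈0) ⟩
      u * n# 0           ≈⟨ solve 1 (λ u → u :* # 0 := # 0) refl u ⟩
      n# 0               ∎

    -- Congruence modulo Q with an explicit certificate: each z below is the quotient of x - y by Q
    -- as polynomials in A.
    modulo-Q : ∀ {x y} z → x ≈ y + Q * z → x ≈ y
    modulo-Q {x} {y} z x≈ = begin
      x              ≈⟨ x≈ ⟩
      y + Q * z      ≈⟨ +-congˡ (*-congʳ Q≈0) ⟩
      y + n# 0 * z   ≈⟨ solve 2 (λ y z → y :+ # 0 :* z := y) refl y z ⟩
      y              ∎

    s₂² : s₂ * s₂ ≈ B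
    s₂² = begin
      s₂ * s₂                                  ≈⟨ *-cong S₂ S₂ ⟩
      n# 2 * s₁ * c₁ * (n# 2 * s₁ * c₁)
        ≈⟨ solve 2 (λ s c → # 2 :* s :* c :* (# 2 :* s :* c) := # 4 :* (s :* s) :* (c :* c)) refl s₁ c₁ ⟩
      n# 4 * A * (c₁ * c₁)                     ≈⟨ *-congˡ c₁² ⟩
      B                                        ∎

    -- Geometrically sin 3θ = sin(π - 2θ) = sin 2θ. The equality of squares already follows from Q ≈
    -- 0, without the value of cos π; likewise for 4θ and θ.
    s₃² : s₃ * s₃ ≈ B
    s₃² = modulo-Q A (begin
      s₃ * s₃                                                 ≈⟨ *-cong S₃ S₃ ⟩
      s₁ * (n# 3 - n# 4 * A) * (s₁ * (n# 3 - n# 4 * A))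
        ≈⟨ solve 2 (λ s d → s :* d :* (s :* d) := (s :* s) :* d :* d) refl s₁ (n# 3 - n# 4 * A) ⟩
      A * (n# 3 - n# 4 * A) * (n# 3 - n# 4 * A)
        ≈⟨ solve 1 (λ a → a :* (# 3 :- # 4 :* a) :* (# 3 :- # 4 :* a) :=
             # 4 :* a :* (# 1 :- a) :+ (# 16 :* a :* a :- # 20 :* a :+ # 5) :* a) refl A ⟩
      B + Q * A                                               ∎)

    s₄² : s₄ * s₄ ≈ A
    s₄² = modulo-Q (A * (n# 3 - n# 4 * A)) (begin
      s₄ * s₄                                                 ≈⟨ *-cong S₄ S₄ ⟩
      n# 4 * s₁ * c₁ * (n# 1 - n# 2 * A) * (n# 4 * s₁ * c₁ * (n# 1 - n# 2 * A))
        ≈⟨ solve 3 (λ s c d → # 4 :* s :* c :* d :* (# 4 :* s :* c :* d) := # 16 :* (s :* s) :* (c :* c) :* d :* d) refl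
             s₁ c₁ (n# 1 - n# 2 * A) ⟩
      n# 16 * A * (c₁ * c₁) * (n# 1 - n# 2 * A) * (n# 1 - n# 2 * A)
        ≈⟨ *-congʳ (*-congʳ (*-congˡ c₁²)) ⟩
      n# 16 * A * (n# 1 - A) * (n# 1 - n# 2 * A) * (n# 1 - n# 2 * A)
        ≈⟨ solve 1 (λ a → # 16 :* a :* (# 1 :- a) :* (# 1 :- # 2 :* a) :* (# 1 :- # 2 :* a) :=
             a :+ (# 16 :* a :* a :- # 20 :* a :+ # 5) :* (a :* (# 3 :- # 4 :* a))) refl A ⟩
      A + Q * (A * (n# 3 - n# 4 * A))                         ∎)

    -- With z = 4A, Q is z² - 5z + 5. Modulo Q the other root 5 - z is 4B, so this and `16AB` are
    -- Vieta's relations.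
    4A+4B : n# 4 * A + n# 4 * B ≈ n# 5
    4A+4B = modulo-Q (- n# 1) (solve 1 (λ a → # 4 :* a :+ # 4 :* (# 4 :* a :* (# 1 :- a)) :=
      # 5 :+ (# 16 :* a :* a :- # 20 :* a :+ # 5) :* (:- # 1)) refl A)

    16AB : n# 16 * A * B ≈ n# 5
    16AB = modulo-Q (- n# 4 * A - n# 1) (solve 1 (λ a → # 16 :* a :* (# 4 :* a :* (# 1 :- a)) :=
      # 5 :+ (# 16 :* a :* a :- # 20 :* a :+ # 5) :* (:- # 4 :* a :- # 1)) refl A)

    16BA : n# 16 * B * A ≈ n# 5
    16BA = trans (solve 2 (λ a b → # 16 :* b :* a := # 16 :* a :* b) refl A B) 16AB

  -- Because 4y · p² = (16xy)² = 25. The 25 is m² for m = 5 and will be supplied by the prefactor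
  -- m²ⁿ.
  inverse-square : ∀ {x y p i} → n# 16 * x * y ≈ n# 5 → p * p ≈ n# 64 * (x * x * y) → p * i ≈ n# 1 →
    n# 25 * (i * i) ≈ n# 4 * y
  inverse-square {x} {y} {p} {i} xy p² pi = sym (begin
    n# 4 * y                               ≈⟨ solve 1 (λ y → # 4 :* y := # 4 :* y :* (# 1 :* # 1)) refl y ⟩
    n# 4 * y * (n# 1 * n# 1)               ≈⟨ *-congˡ (*-cong pi pi) ⟨
    n# 4 * y * (p * i * (p * i))           ≈⟨ solve 3 (λ y p i → # 4 :* y :* (p :* i :* (p :* i)) := # 4 :* y :* (p :* p) :* (i :* i)) refl y p i ⟩
    n# 4 * y * (p * p) * (i * i)           ≈⟨ *-congʳ (*-congˡ p²) ⟩
    n# 4 * y * (n# 64 * (x * x * y)) * (i * i)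
      ≈⟨ solve 3 (λ x y i → # 4 :* y :* (# 64 :* (x :* x :* y)) :* (i :* i) := (# 16 :* x :* y) :* (# 16 :* x :* y) :* (i :* i)) refl x y i ⟩
    (n# 16 * x * y) * (n# 16 * x * y) * (i * i)
                                           ≈⟨ *-congʳ (*-cong xy xy) ⟩
    n# 5 * n# 5 * (i * i)                  ≈⟨ *-congʳ (solve 0 (# 5 :* # 5 := # 25) refl) ⟩
    n# 25 * (i * i)                        ∎)

  -- U is the square that occurs twice among X, Y, Z and W the one that occurs once; the hypothesis
  -- on XYZ absorbs their order.
  sine-product : ∀ {x y z X Y Z U W p i} → p ≈ n# 8 * x * y * z → x * x ≈ X → y * y ≈ Y → z * z ≈ Z →
    X * Y * Z ≈ U * U * W → n# 16 * U * W ≈ n# 5 → p * i ≈ n# 1 → n# 25 * (i * i) ≈ n# 4 * W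
  sine-product {x} {y} {z} {X} {Y} {Z} {U} {W} {p} p≈ x² y² z² XYZ UW pi = inverse-square UW (begin
    p * p                                         ≈⟨ *-cong p≈ p≈ ⟩
    n# 8 * x * y * z * (n# 8 * x * y * z)         ≈⟨ solve 3 (λ x y z → # 8 :* x :* y :* z :* (# 8 :* x :* y :* z) :=
                                                       # 64 :* ((x :* x) :* (y :* y) :* (z :* z))) refl x y z ⟩
    n# 64 * (x * x * (y * y) * (z * z))           ≈⟨ *-congˡ (*-cong (*-cong x² y²) z²) ⟩
    n# 64 * (X * Y * Z)                           ≈⟨ *-congˡ XYZ ⟩
    n# 64 * (U * U * W)                           ∎) pi

  xyx≈xxy : ∀ x y → x * y * x ≈ x * x * y
  xyx≈xxy = solve 2 (λ x y → x :* y :* x := x :* x :* y) refl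

  yxx≈xxy : ∀ x y → y * x * x ≈ x * x * y
  yxx≈xxy = solve 2 (λ x y → y :* x :* x := x :* x :* y) refl

  n#-^ : ∀ m n → n# (m ℕ.^ n) ≈ n# m ^ n
  n#-^ m zero    = 1-homo
  n#-^ m (suc n) = trans (reflexive (≡.cong ⟦_⟧ (ι-* m (m ℕ.^ n))))
    (trans (*-homo (ι m) (ι (m ℕ.^ n))) (*-congˡ (n#-^ m n)))

  scaled-power : ∀ {i z} n → n# 25 * (i * i) ≈ z →
    n# (3 ℕ.^ n ℕ.* 5 ℕ.^ (2 ℕ.* n)) * i ^ (2 ℕ.* n) ≈ n# (3 ℕ.^ n) * z ^ n
  scaled-power {i} {z} n h = begin
    n# (3 ℕ.^ n ℕ.* 5 ℕ.^ (2 ℕ.* n)) * i ^ (2 ℕ.* n)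
      ≈⟨ *-cong (trans (reflexive (≡.cong ⟦_⟧ (ι-* (3 ℕ.^ n) (5 ℕ.^ (2 ℕ.* n))))) (*-homo (ι (3 ℕ.^ n)) (ι (5 ℕ.^ (2 ℕ.* n)))))
                (sym (^-assocʳ i 2 n)) ⟩
    n# (3 ℕ.^ n) * n# (5 ℕ.^ (2 ℕ.* n)) * (i ^ 2) ^ n
      ≈⟨ *-assoc (n# (3 ℕ.^ n)) (n# (5 ℕ.^ (2 ℕ.* n))) ((i ^ 2) ^ n) ⟩
    n# (3 ℕ.^ n) * (n# (5 ℕ.^ (2 ℕ.* n)) * (i ^ 2) ^ n)
      ≈⟨ *-congˡ (*-congʳ (trans (reflexive (≡.cong n# (≡.sym (ℕ.^-*-assoc 5 2 n)))) (n#-^ 25 n))) ⟩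
    n# (3 ℕ.^ n) * (n# 25 ^ n * (i ^ 2) ^ n)
      ≈⟨ *-congˡ (^-distrib-* (n# 25) (i ^ 2) n) ⟨
    n# (3 ℕ.^ n) * (n# 25 * i ^ 2) ^ n
      ≈⟨ *-congˡ (^-congˡ n (trans (*-congˡ (*-congˡ (*-identityʳ i))) h)) ⟩
    n# (3 ℕ.^ n) * z ^ n ∎

  sum : List Carrier → Carrier
  sum = List.foldr _+_ 0#

  sum-scale : ∀ {k xs ys} → Pointwise (λ x y → k * x ≈ y) xs ys → k * sum xs ≈ sum ys
  sum-scale {k} []       = zeroʳ k
  sum-scale {k} (p ∷ ps) = trans (distribˡ k _ _) (+-cong p (sum-scale ps))

  -- The summands follow the order of triples isPi 5.
  sum-of-twelve : ∀ t a b → let x = t * a ; y = t * b in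
    sum (y ∷ x ∷ y ∷ x ∷ x ∷ y ∷ y ∷ x ∷ x ∷ y ∷ x ∷ y ∷ []) ≈ n# 6 * t * (a + b)
  sum-of-twelve t a b = trans
    -- The fold ends in `0#`, which is not syntactically a constant coming from ℚ and is removed
    -- before solving.
    (+-congˡ (+-congˡ (+-congˡ (+-congˡ (+-congˡ (+-congˡ (+-congˡ (+-congˡ (+-congˡ (+-congˡ (+-congˡ (+-identityʳ _))))))))))))
    (solve 3 (λ t a b → let x = t :* a ; y = t :* b in
      y :+ (x :+ (y :+ (x :+ (x :+ (y :+ (y :+ (x :+ (x :+ (y :+ (x :+ y)))))))))) := # 6 :* t :* (a :+ b)) refl t a b)

  n#-* : ∀ m n → n# m * n# n ≈ n# (m ℕ.* n)
  n#-* m n = trans (sym (*-homo (ι m) (ι n))) (reflexive (≡.cong ⟦_⟧ (≡.sym (ι-* m n))))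

  -- Power sums and Fibonacci numbers

  module PowerSums {x y : Carrier} (x+y : x + y ≈ n# 5) (xy : x * y ≈ n# 5) where

    powerSum : ℕ → Carrier
    powerSum n = x ^ n + y ^ n

    recurrence : ∀ n → powerSum (2 ℕ.+ n) ≈ n# 5 * powerSum (1 ℕ.+ n) - n# 5 * powerSum n
    recurrence n = begin
      powerSum (2 ℕ.+ n)
        ≈⟨ solve 4 (λ x y p q → x :* (x :* p) :+ y :* (y :* q) := (x :+ y) :* (x :* p :+ y :* q) :- x :* y :* (p :+ q)) refl
             x y (x ^ n) (y ^ n) ⟩
      (x + y) * powerSum (1 ℕ.+ n) - x * y * powerSum n
        ≈⟨ +-cong (*-congʳ x+y) (-‿cong (*-congʳ xy)) ⟩
      n# 5 * powerSum (1 ℕ.+ n) - n# 5 * powerSum n ∎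

    step : ∀ i j k n → powerSum n ≈ n# i → powerSum (1 ℕ.+ n) ≈ n# j → 5 ℕ.* j ≡ k ℕ.+ 5 ℕ.* i →
      powerSum (2 ℕ.+ n) ≈ n# k
    step i j k n pi pj eq = begin
      powerSum (2 ℕ.+ n)                                ≈⟨ recurrence n ⟩
      n# 5 * powerSum (1 ℕ.+ n) - n# 5 * powerSum n     ≈⟨ +-cong (*-congˡ pj) (-‿cong (*-congˡ pi)) ⟩
      n# 5 * n# j - n# 5 * n# i                         ≈⟨ +-congʳ (*-homo (ι 5) (ι j)) ⟨
      ⟦ ι 5 ℚ.* ι j ⟧ - n# 5 * n# i                     ≡⟨ ≡.cong (λ q → ⟦ q ⟧ - n# 5 * n# i) q≡ ⟩
      ⟦ ι k ℚ.+ ι 5 ℚ.* ι i ⟧ - n# 5 * n# i             ≈⟨ +-congʳ (trans (+-homo (ι k) (ι 5 ℚ.* ι i)) (+-congˡ (*-homo (ι 5) (ι i)))) ⟩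
      n# k + n# 5 * n# i - n# 5 * n# i                  ≈⟨ solve 2 (λ k m → k :+ m :- m := k) refl (n# k) (n# 5 * n# i) ⟩
      n# k                                              ∎
      where
      q≡ : ι 5 ℚ.* ι j ≡ ι k ℚ.+ ι 5 ℚ.* ι i
      q≡ = ≡.trans (≡.sym (ι-* 5 j)) (≡.trans (≡.cong ι eq)
        (≡.trans (ι-+ k (5 ℕ.* i)) (≡.cong (ι k ℚ.+_) (ι-* 5 i))))

    -- The recurrence has order two, so two consecutive values are carried. With n = k · 2, passing
    -- to `suc k` turns n into 2 + n by computation.
    powerSum-fib : ∀ k → let n = k ℕ.* 2 in
      powerSum (1 ℕ.+ n) ≈ n# (5 ℕ.^ suc k ℕ.* fib (1 ℕ.+ n)) ×
      powerSum (2 ℕ.+ n) ≈ n# (5 ℕ.^ suc k ℕ.* (fib (1 ℕ.+ n) ℕ.+ fib (3 ℕ.+ n)))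
    -- The first values are p₀ = 2, p₁ = 5 and p₂ = 5 · 5 - 5 · 2 = 15 = 5(F₁ + F₃).
    powerSum-fib zero = p₁ , step 2 5 15 0 p₀ p₁ ≡.refl
      where
      p₀ : powerSum 0 ≈ n# 2
      p₀ = trans (+-cong (sym 1-homo) (sym 1-homo)) (solve 0 (# 1 :+ # 1 := # 2) refl)
      p₁ : powerSum 1 ≈ n# 5
      p₁ = trans (+-cong (*-identityʳ x) (*-identityʳ y)) x+y
    powerSum-fib (suc k) =
      let p , q = powerSum-fib k
          n = k ℕ.* 2
          t = 5 ℕ.^ suc k
          v = fib (2 ℕ.+ n)
          w = fib (1 ℕ.+ n)
          a₁ = t ℕ.* w
          a₂ = t ℕ.* (w ℕ.+ (v ℕ.+ w))
          a₃ = 5 ℕ.* t ℕ.* (v ℕ.+ w)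
          a₄ = 5 ℕ.* t ℕ.* ((v ℕ.+ w) ℕ.+ (((v ℕ.+ w) ℕ.+ v) ℕ.+ (v ℕ.+ w)))
          p′ = step a₁ a₂ a₃ (1 ℕ.+ n) p q (odd-step t v w)
      in p′ , step a₂ a₃ a₄ (2 ℕ.+ n) q p′ (even-step t v w)

constantMorphism : ℚ.+-*-rawRing -Raw-AlmostCommutative⟶ fromCommutativeRing Sequences.commutativeRing
constantMorphism = record
  { ⟦_⟧    = constant
  ; +-homo = λ _ _ → pointwise (λ _ → ≡.refl)
  ; *-homo = λ _ _ → pointwise (λ _ → ≡.refl)
  ; -‿homo = λ _ → pointwise (λ _ → ≡.refl)
  ; 0-homo = pointwise (λ _ → ≡.refl)
  ; 1-homo = pointwise (λ _ → ≡.refl)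
  }
  where open Sequences

-- Evaluation of the Verlinde sum at m = 5

module VerlindeSum {π : ℝ} (isPi : IsPi π) where

  open RationalLemmas using (ι)
  open Sequences using (BoundedSeq; seq; constant; pointwise; seq~; mk≈; ⌊_⌋; ⌊⌋-inverse; commutativeRing; close)
  open Trigonometry
  open CommutativeRing commutativeRing hiding (zero)
  open Pentagon commutativeRing constantMorphism
  open ℕIdentities using (regroup)
  open import Algebra.Properties.Semiring.Exp semiring using (_^_)
  open import Relation.Binary.Reasoning.Setoid setoid

  open import Data.Integer.Base using (+_)
  open ℚ.+-*-Solver using (solve; _:+_; _:*_; _:=_; con)

  θ : Residue 5 → BoundedSeq
  θ j = ⌊ angle π 5 j ⌋

  -- sⱼ = sin(jπ/5) and cⱼ = cos(jπ/5); the index jF stands for the residue j + 1.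
  s₁ s₂ s₃ s₄ s₅ c₁ c₂ c₃ : BoundedSeq
  s₁ = Sin (θ 0F)
  s₂ = Sin (θ 1F)
  s₃ = Sin (θ 2F)
  s₄ = Sin (θ 3F)
  s₅ = Sin ⌊ π ⌋
  c₁ = Cos (θ 0F)
  c₂ = Cos (θ 1F)
  c₃ = Cos (θ 2F)

  -- The angles agree term by term, not merely up to a null sequence, so the termwise `Sin-cong` and
  -- `Cos-cong` apply.
  θ₂ : ∀ n → seq (θ 1F) n ≡ seq (θ 0F + θ 0F) n
  θ₂ n = solve 1 (λ p → p :* con (+ 2 ℚ./ 5) := p :* con (+ 1 ℚ./ 5) :+ p :* con (+ 1 ℚ./ 5)) ≡.refl (ℝ.seq π n)

  θ₃ : ∀ n → seq (θ 2F) n ≡ seq (θ 1F + θ 0F) n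
  θ₃ n = solve 1 (λ p → p :* con (+ 3 ℚ./ 5) := p :* con (+ 2 ℚ./ 5) :+ p :* con (+ 1 ℚ./ 5)) ≡.refl (ℝ.seq π n)

  θ₄ : ∀ n → seq (θ 3F) n ≡ seq (θ 1F + θ 1F) n
  θ₄ n = solve 1 (λ p → p :* con (+ 4 ℚ./ 5) := p :* con (+ 2 ℚ./ 5) :+ p :* con (+ 2 ℚ./ 5)) ≡.refl (ℝ.seq π n)

  θ₅ : ∀ n → seq ⌊ π ⌋ n ≡ seq (θ 1F + θ 2F) n
  θ₅ n = solve 1 (λ p → p := p :* con (+ 2 ℚ./ 5) :+ p :* con (+ 3 ℚ./ 5)) ≡.refl (ℝ.seq π n)

  P I : Residue 5 → Residue 5 → Residue 5 → BoundedSeq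
  P j l k = ⌊ sinProduct isPi 5 j l k ⌋
  I j l k = ⌊ inverse (sinProduct isPi 5 j l k) (sinProduct#0 isPi 5 j l k) ⌋

  P≈ : ∀ j l k → P j l k ≈ constant (ι 8) * Sin (θ j) * Sin (θ l) * Sin (θ k)
  P≈ j l k = pointwise (λ _ → ≡.refl)

  P*I : ∀ j l k → P j l k * I j l k ≈ constant 1ℚ
  P*I j l k = ⌊⌋-inverse (sinProduct isPi 5 j l k) (sinProduct#0 isPi 5 j l k)

  -- The residue triple (1, 1, 1) is not a summand, but its product 8s₁³ is also apart from 0; its
  -- inverse times 8s₁² inverts s₁.
  s₁-inverse : s₁ * (constant (ι 8) * s₁ * s₁ * I 0F 0F 0F) ≈ constant 1ℚ
  s₁-inverse = trans
    (pointwise (λ n → solve 2 (λ s i → s :* (con (ι 8) :* s :* s :* i) := con (ι 8) :* s :* s :* s :* i) ≡.refl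
      (seq s₁ n) (seq (I 0F 0F 0F) n)))
    (P*I 0F 0F 0F)

  s₅≈0 : s₅ ≈ constant 0ℚ
  s₅≈0 = mk≈ (Sequences.mk~ (_≃_.close (IsPi.sin-π isPi)))

  open Sines {s₁} {s₂} {s₃} {s₄} {s₅} {c₁} {c₂} {c₃} (pythagoras (θ 0F))
    (trans (Sin-cong θ₂) (Sin-+ (θ 0F) (θ 0F))) (trans (Cos-cong θ₂) (Cos-+ (θ 0F) (θ 0F)))
    (trans (Sin-cong θ₃) (Sin-+ (θ 1F) (θ 0F))) (trans (Cos-cong θ₃) (Cos-+ (θ 1F) (θ 0F)))
    (trans (Sin-cong θ₄) (Sin-+ (θ 1F) (θ 1F))) (trans (Sin-cong θ₅) (Sin-+ (θ 1F) (θ 2F)))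
    s₅≈0 s₁-inverse

  square : Residue 5 → BoundedSeq
  square 0F = A
  square 1F = B
  square 2F = B
  square 3F = A

  Sin² : ∀ j → Sin (θ j) * Sin (θ j) ≈ square j
  Sin² 0F = refl
  Sin² 1F = s₂²
  Sin² 2F = s₃²
  Sin² 3F = s₄²

  I² : ∀ j l k {U W} → square j * square l * square k ≈ U * U * W → constant (ι 16) * U * W ≈ constant (ι 5) →
    constant (ι 25) * (I j l k * I j l k) ≈ constant (ι 4) * W
  I² j l k h UW = sine-product (P≈ j l k) (Sin² j) (Sin² l) (Sin² k) h UW (P*I j l k)

  open PowerSums {constant (ι 4) * A} {constant (ι 4) * B} 4A+4B
    (trans (pointwise (λ n → solve 2 (λ a b → con (ι 4) :* a :* (con (ι 4) :* b) := con (ι 16) :* a :* b) ≡.refl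
      (seq A n) (seq B n))) 16AB)

  ⌊⌋-^ : ∀ x n → ⌊ x Defs.^ n ⌋ ≈ ⌊ x ⌋ ^ n
  ⌊⌋-^ x n = pointwise (λ i → go n i)
    where
    go : ∀ n i → ℝ.seq (x Defs.^ n) i ≡ seq (⌊ x ⌋ ^ n) i
    go zero    i = ≡.refl
    go (suc n) i = ≡.cong (ℝ.seq x i ℚ.*_) (go n i)

  ⌊⌋-sum : ∀ xs → ⌊ sumℝ xs ⌋ ≈ sum (List.map ⌊_⌋ xs)
  ⌊⌋-sum xs = pointwise (go xs)
    where
    go : ∀ xs i → ℝ.seq (sumℝ xs) i ≡ seq (sum (List.map ⌊_⌋ xs)) i
    go []       i = ≡.refl
    go (x ∷ xs) i = ≡.cong (ℝ.seq x i ℚ.+_) (go xs i)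

  verlinde≈ : ∀ n → ⌊ verlinde isPi 5 n ⌋ ≈ constant (ι 6) * constant (ι (3 ℕ.^ n)) * powerSum n
  verlinde≈ n = begin
    ⌊ verlinde isPi 5 n ⌋
      ≈⟨ pointwise (λ _ → ≡.refl) ⟩
    κ * ⌊ sumℝ (List.map term (triples isPi 5)) ⌋
      ≈⟨ *-congˡ {κ} (⌊⌋-sum (List.map term (triples isPi 5))) ⟩
    κ * sum (List.map ⌊_⌋ (List.map term (triples isPi 5)))
      -- `triples isPi 5` evaluates to twelve triples, listed here in its order. `a` treats those
      -- with B twice and A once, which contribute (4A)ⁿ; `b` treats the reverse.
      ≈⟨ sum-scale
           ( b 0F 0F 2F refl ∷ a 0F 1F 1F (yxx≈xxy B A) ∷ b 0F 2F 0F (xyx≈xxy A B) ∷ a 1F 0F 1F (xyx≈xxy B A)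
           ∷ a 1F 1F 0F refl ∷ b 1F 3F 3F (yxx≈xxy A B) ∷ b 2F 0F 0F (yxx≈xxy A B) ∷ a 2F 2F 3F refl
           ∷ a 2F 3F 2F (xyx≈xxy B A) ∷ b 3F 1F 3F (xyx≈xxy A B) ∷ a 3F 2F 2F (yxx≈xxy B A) ∷ b 3F 3F 1F refl ∷ []) ⟩
    sum (y ∷ x ∷ y ∷ x ∷ x ∷ y ∷ y ∷ x ∷ x ∷ y ∷ x ∷ y ∷ [])
      ≈⟨ sum-of-twelve t ((constant (ι 4) * A) ^ n) ((constant (ι 4) * B) ^ n) ⟩
    constant (ι 6) * t * powerSum n ∎
    where
    κ t x y : BoundedSeq
    κ = constant (ι (3 ℕ.^ n ℕ.* 5 ℕ.^ (2 ℕ.* n)))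
    t = constant (ι (3 ℕ.^ n))
    x = t * (constant (ι 4) * A) ^ n
    y = t * (constant (ι 4) * B) ^ n
    term : Residue 5 × Residue 5 × Residue 5 → ℝ
    term (j , l , k) = inverse (sinProduct isPi 5 j l k) (sinProduct#0 isPi 5 j l k) Defs.^ (2 ℕ.* n)
    power : ∀ j l k {z} → constant (ι 25) * (I j l k * I j l k) ≈ z → κ * ⌊ term (j , l , k) ⌋ ≈ t * z ^ n
    power j l k h = trans
      (*-congˡ {κ} (⌊⌋-^ (inverse (sinProduct isPi 5 j l k) (sinProduct#0 isPi 5 j l k)) (2 ℕ.* n)))
      (scaled-power n h)
    a : ∀ j l k → square j * square l * square k ≈ B * B * A → κ * ⌊ term (j , l , k) ⌋ ≈ x
    a j l k h = power j l k (I² j l k h 16BA)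
    b : ∀ j l k → square j * square l * square k ≈ A * A * B → κ * ⌊ term (j , l , k) ⌋ ≈ y
    b j l k h = power j l k (I² j l k h 16AB)

  verlinde≃ : ∀ n {i j} → powerSum n ≈ constant (ι i) → 6 ℕ.* 3 ℕ.^ n ℕ.* i ≡ j → verlinde isPi 5 n ≃ fromℕ j
  verlinde≃ n {i} {j} h eq = mk≃ (close (seq~ (begin
    ⌊ verlinde isPi 5 n ⌋                                       ≈⟨ verlinde≈ n ⟩
    constant (ι 6) * constant (ι (3 ℕ.^ n)) * powerSum n        ≈⟨ *-cong (n#-* 6 (3 ℕ.^ n)) h ⟩
    constant (ι (6 ℕ.* 3 ℕ.^ n)) * constant (ι i)               ≈⟨ n#-* (6 ℕ.* 3 ℕ.^ n) i ⟩
    constant (ι (6 ℕ.* 3 ℕ.^ n ℕ.* i))                          ≡⟨ ≡.cong (constant ∘ ι) eq ⟩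
    constant (ι j)                                              ∎)))

  -- The components are the cases g = n + 2 and g = n + 3 of the theorem.
  verlinde-fib : ∀ k → let n = k ℕ.* 2 in
    verlinde isPi 5 (1 ℕ.+ n) ≃ fromℕ (2 ℕ.* 3 ℕ.^ (2 ℕ.+ n) ℕ.* 5 ℕ.^ suc k ℕ.* fib (1 ℕ.+ n)) ×
    verlinde isPi 5 (2 ℕ.+ n) ≃ fromℕ (2 ℕ.* 3 ℕ.^ (3 ℕ.+ n) ℕ.* 5 ℕ.^ suc k ℕ.* (fib (1 ℕ.+ n) ℕ.+ fib (3 ℕ.+ n)))
  verlinde-fib k = let n = k ℕ.* 2 ; p , q = powerSum-fib k in
    verlinde≃ (1 ℕ.+ n) p (regroup (3 ℕ.^ (1 ℕ.+ n)) (5 ℕ.^ suc k) (fib (1 ℕ.+ n))) ,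
    verlinde≃ (2 ℕ.+ n) q (regroup (3 ℕ.^ (2 ℕ.+ n)) (5 ℕ.^ suc k) (fib (1 ℕ.+ n) ℕ.+ fib (3 ℕ.+ n)))

-- The two parities of g

open import Defs using (IsPi; verlinde; _≃_; fromℕ; fib)
open import Data.Nat using (ℕ; _<_; _+_; _*_; _∸_; _^_; _/_)
open import Data.Nat.Divisibility using (_∣_; _∤_)
open import Data.Product using (_×_)

-- Supplies the witness k for odd g, which the negative statement 2 ∤ g does not carry.
even-or-odd : ∀ g → ∃[ k ] (g ≡ k * 2 ⊎ g ≡ suc (k * 2))
even-or-odd zero    = 0 , inj₁ ≡.refl
even-or-odd (suc g) with even-or-odd g
... | k , inj₁ g≡ = k , inj₂ (≡.cong suc g≡)
... | k , inj₂ g≡ = suc k , inj₁ (≡.cong suc g≡)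

mainTheorem6 : ∀ {π} (isPi : IsPi π) (g : ℕ) → 1 < g →
    (2 ∣ g → verlinde isPi 5 (g ∸ 1) ≃ fromℕ (2 * 3 ^ g * 5 ^ (g / 2) * fib (g ∸ 1))) ×
    (2 ∤ g → verlinde isPi 5 (g ∸ 1) ≃ fromℕ (2 * 3 ^ g * 5 ^ ((g ∸ 1) / 2) * (fib (g ∸ 2) + fib g)))
mainTheorem6 isPi g 1<g = even g 1<g , odd g 1<g (even-or-odd g)
  where
  open VerlindeSum isPi
  even : ∀ g → 1 < g → 2 ∣ g → verlinde isPi 5 (g ∸ 1) ≃ fromℕ (2 * 3 ^ g * 5 ^ (g / 2) * fib (g ∸ 1))
  -- The quotient 0 would give g = 0, against 1 < g. Now g computes to 2 + k · 2, and only the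
  -- exponent g / 2 has to be rewritten.
  even _ _ (divides (suc k) ≡.refl) =
    ≡.subst (λ h → verlinde isPi 5 (1 + k * 2) ≃ fromℕ (2 * 3 ^ (2 + k * 2) * 5 ^ h * fib (1 + k * 2)))
      (≡.sym (m*n/n≡m (suc k) 2)) (proj₁ (verlinde-fib k))
  odd : ∀ g → 1 < g → ∃[ k ] (g ≡ k * 2 ⊎ g ≡ suc (k * 2)) → 2 ∤ g →
    verlinde isPi 5 (g ∸ 1) ≃ fromℕ (2 * 3 ^ g * 5 ^ ((g ∸ 1) / 2) * (fib (g ∸ 2) + fib g))
  odd _ _ (k , inj₁ g≡) 2∤g = contradiction (divides k g≡) 2∤g
  odd _ (s≤s ()) (zero , inj₂ ≡.refl) _
  odd _ _ (suc k , inj₂ ≡.refl) _ =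
    ≡.subst (λ h → verlinde isPi 5 (2 + k * 2) ≃ fromℕ (2 * 3 ^ (3 + k * 2) * 5 ^ h * (fib (1 + k * 2) + fib (3 + k * 2))))
      (≡.sym (m*n/n≡m (suc k) 2)) (proj₂ (verlinde-fib k))
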